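{- Let $d\ge 2$ be an integer. Let the constants $c_k$ ($k\ge 0$) be defined recursively by $c_0=c_1=1$ and $$c_{ds+b}=\binom{d}{b}\,\frac{c_s^{\,d-b}\, c_{s+1}^{\,b}}{d^{ds+b}-d}$$ for all integers $s\ge 0$ and $b\in\{0,1,\ldots,d-1\}$ with $ds+b\ge 2$. Then for every $k\ge 1$, the $d$-ary inducibility of the even $d$-ary tree $E_k^d$ is $I_d(E_k^d)=k!\,c_k$.
   Context: A $d$-ary tree is a finite rooted tree in which every internal (non-leaf) vertex has at least two and at most $d$ children; a single vertex is a $d$-ary tree with one leaf. Isomorphism of rooted trees means root-preserving isomorphism. $\|T\|$ denotes the number of leaves of $T$. A set $S$ of leaves of $T$ induces a $d$-ary tree: take the smallest subtree of $T$ containing all leaves in $S$ (rooted at the most recent common ancestor of $S$) and repeatedly suppress every vertex with exactly one child (contracting its two adjacent edges to a single edge). $c(D,T)$ is the number of sets of $\|D\|$ leaves of $T$ that induce a tree isomorphic to $D$, and $\gamma(D,T)=c(D,T)/\binom{\|T\|}{\|D\|}$. The $d$-ary inducibility of a $d$-ary tree $D$ is $$I_d(D)=\limsup_{n\to\infty}\ \max_{\substack{\|T\|=n\\ T\ d\text{ -ary tree}}}\gamma(D,T).$$ Even $d$-ary trees $E_k^d$ (with $k$ leaves) are defined recursively: $E_1^d$ is a single vertex; for $2\le k\le d$, $E_k^d$ is the star consisting of a root and $k$ leaves attached to it; for $k>d$, write $k=ds+b$ with $b\in\{0,1,\ldots,d-1\}$, take $d-b$ copies of $E_s^d$ and $b$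 copies of $E_{s+1}^d$, and connect a new common root to each of their roots by an edge to obtain $E_k^d$. -}

module Defs where

open import Algebra.Definitions.RawSemiring using (_^_)
open import Data.Fin.Subset using (Subset; inside; outside; ∣_∣)
open import Data.Integer using (+_)
open import Data.List using (List; []; _∷_; _++_; length; map; filter; replicate)
open import Data.List.Relation.Binary.Permutation.Homogeneous as Homogeneous using (Permutation; prep; swap)
open import Data.List.Relation.Binary.Pointwise using (Pointwise; []; _∷_)
open import Data.List.Relation.Unary.All using (All)
open import Data.List.Relation.Unary.Any using (here; any?)
open import Data.Maybe as Maybe using (Maybe; just; nothing)
open import Data.Nat as ℕ using (ℕ; zero; suc)
open import Data.Nat.Combinatorics using (_C_)
open import Data.Nat.Properties using (0≢1+n)
open import Data.Product using (Σ; ∃-syntax; _×_; _,_)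
open import Data.Rational as ℚ using (ℚ; 0ℚ; 1ℚ; _/_)
open import Data.Vec using ([]; _∷_; take; drop)
open import Level using (0ℓ)
open import Relation.Binary using (Setoid; IsEquivalence; Reflexive; Symmetric; Transitive; Decidable)
open import Relation.Binary.PropositionalEquality using (_≡_; refl)
open import Relation.Nullary using (Dec; yes; no)
open import Relation.Nullary.Decidable using (map′)
open import Relation.Unary using (Pred)
import Data.List.Membership.Setoid.Properties as Membership
import Data.List.Relation.Binary.Permutation.Setoid as SetoidPermutation
import Data.List.Relation.Binary.Permutation.Setoid.Properties as PermutationProperties

-- Finite rooted trees.  The order in which the children are listed is
-- immaterial: trees are only ever compared up to _≅_.

data Tree : Set where
  node : List Tree → Tree

pattern leaf = node []

data IsDAry (d : ℕ) : Tree → Set where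
  leaf-dary : IsDAry d leaf
  node-dary : ∀ {ts} → 2 ℕ.≤ length ts → length ts ℕ.≤ d →
              All (IsDAry d) ts → IsDAry d (node ts)

mutual
  ‖_‖ : Tree → ℕ
  ‖ leaf ‖          = 1
  ‖ node (t ∷ ts) ‖ = ‖ t ∷ ts ‖ₗ

  ‖_‖ₗ : List Tree → ℕ
  ‖ [] ‖ₗ     = 0
  ‖ t ∷ ts ‖ₗ = ‖ t ‖ ℕ.+ ‖ ts ‖ₗ

-- A root-preserving isomorphism matches the children of the two roots
-- bijectively so that the branches at matched children are isomorphic.

infix 4 _≅_

data _≅_ : Tree → Tree → Set where
  permute : ∀ {ts us} → Permutation _≅_ ts us → node ts ≅ node us

mutual
  ≅-refl : Reflexive _≅_
  ≅-refl {node ts} = permute (Homogeneous.refl (≅-refls ts))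

  ≅-refls : ∀ ts → Pointwise _≅_ ts ts
  ≅-refls []       = []
  ≅-refls (t ∷ ts) = ≅-refl ∷ ≅-refls ts

mutual
  ≅-sym : Symmetric _≅_
  ≅-sym (permute p) = permute (≅-sym-perm p)

  ≅-sym-perm : Symmetric (Permutation _≅_)
  ≅-sym-perm (Homogeneous.refl es)   = Homogeneous.refl (≅-sym-pw es)
  ≅-sym-perm (prep e p)              = prep (≅-sym e) (≅-sym-perm p)
  ≅-sym-perm (swap e f p)            = swap (≅-sym f) (≅-sym e) (≅-sym-perm p)
  ≅-sym-perm (Homogeneous.trans p q) = Homogeneous.trans (≅-sym-perm q) (≅-sym-perm p)

  ≅-sym-pw : Symmetric (Pointwise _≅_)
  ≅-sym-pw []       = []
  ≅-sym-pw (e ∷ es) = ≅-sym e ∷ ≅-sym-pw es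

≅-trans : Transitive _≅_
≅-trans (permute p) (permute q) = permute (Homogeneous.trans p q)

≅-isEquivalence : IsEquivalence _≅_
≅-isEquivalence = record { refl = ≅-refl ; sym = ≅-sym ; trans = ≅-trans }

≅-setoid : Setoid 0ℓ 0ℓ
≅-setoid = record { isEquivalence = ≅-isEquivalence }

open SetoidPermutation ≅-setoid using (_↭_; ↭-sym; ↭-trans; ↭-prep; ↭-reflexive-≋)
open PermutationProperties ≅-setoid using (∈-resp-↭; drop-∷; shift; xs↭ys⇒|xs|≡|ys|)

mutual
  _≅?_ : Decidable _≅_
  node ts ≅? node us = map′ permute (λ { (permute p) → p }) (ts ↭? us)

  _↭?_ : Decidable _↭_
  []       ↭? []      = yes (Homogeneous.refl [])
  []       ↭? (_ ∷ _) = no λ p → 0≢1+n (xs↭ys⇒|xs|≡|ys| p)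
  (t ∷ ts) ↭? us with any? (t ≅?_) us
  ... | no  t∉us = no λ p → t∉us (∈-resp-↭ p (here ≅-refl))
  ... | yes t∈us with Membership.∈-∃++ ≅-setoid t∈us
  ...   | vs , ws , u , t≅u , us≋ = map′ (λ p → ↭-trans (↭-prep t p) (↭-sym us↭))
                                         (λ p → drop-∷ (↭-trans p us↭))
                                         (ts ↭? (vs ++ ws))
    where
    us↭ : us ↭ t ∷ (vs ++ ws)
    us↭ = ↭-trans (↭-reflexive-≋ us≋) (shift (≅-sym t≅u) vs ws)

-- prune T S consists of the paths from the root of T to the leaves in S
-- (nothing if S is empty); leaves are numbered from left to right.

mutual
  prune : (T : Tree) → Subset ‖ T ‖ → Maybe Tree
  prune leaf (inside  ∷ []) = just leaf
  prune leaf (outside ∷ []) = nothing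
  prune (node (t ∷ ts)) S with pruneₗ (t ∷ ts) S
  ... | []     = nothing
  ... | u ∷ us = just (node (u ∷ us))

  pruneₗ : (ts : List Tree) → Subset ‖ ts ‖ₗ → List Tree
  pruneₗ []       S = []
  pruneₗ (t ∷ ts) S with prune t (take ‖ t ‖ S)
  ... | nothing = pruneₗ ts (drop ‖ t ‖ S)
  ... | just u  = u ∷ pruneₗ ts (drop ‖ t ‖ S)

-- Suppresses every vertex with exactly one child.  Applied to the result of
-- prune this also moves the root down to the most recent common ancestor of
-- the selected leaves.

mutual
  suppress : Tree → Tree
  suppress leaf                = leaf
  suppress (node (t ∷ []))     = suppress t
  suppress (node (t ∷ u ∷ us)) = node (suppress t ∷ suppress u ∷ suppressₗ us)

  suppressₗ : List Tree → List Tree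
  suppressₗ []       = []
  suppressₗ (t ∷ ts) = suppress t ∷ suppressₗ ts

induced : (T : Tree) → Subset ‖ T ‖ → Maybe Tree
induced T S = Maybe.map suppress (prune T S)

Induces : (D T : Tree) → Subset ‖ T ‖ → Set
Induces D T S = ∃[ U ] induced T S ≡ just U × U ≅ D

induces? : ∀ D T S → Dec (Induces D T S)
induces? D T S with induced T S
... | nothing = no λ { (_ , () , _) }
... | just U  = map′ (λ e → U , refl , e) (λ { (_ , refl , e) → e }) (U ≅? D)

subsets : ∀ n → List (Subset n)
subsets zero    = [] ∷ []
subsets (suc n) = map (inside ∷_) (subsets n) ++ map (outside ∷_) (subsets n)

copies : (D T : Tree) → ℕ
copies D T = length (filter (induces? D T) (filter (λ S → ∣ S ∣ ℕ.≟ ‖ D ‖) (subsets ‖ T ‖)))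

fromℕ : ℕ → ℚ
fromℕ n = + n / 1

infixr 8 _^ℚ_

_^ℚ_ : ℚ → ℕ → ℚ
_^ℚ_ = _^_ ℚ.+-*-rawSemiring

-- Division with the convention p ÷₀ 0 = 0.

infixl 7 _÷₀_

_÷₀_ : ℚ → ℚ → ℚ
p ÷₀ q with q ℚ.≟ 0ℚ
... | yes _   = 0ℚ
... | no  q≢0 = ℚ._÷_ p q {{ℚ.≢-nonZero q≢0}}

-- The denominator vanishes only for ‖ T ‖ < ‖ D ‖, which does not affect the
-- limit superior below.

γ : (D T : Tree) → ℚ
γ D T = fromℕ (copies D T) ÷₀ fromℕ (‖ T ‖ C ‖ D ‖)

IsMaximum : Pred ℚ 0ℓ → ℚ → Set
IsMaximum P m = P m × (∀ q → P q → q ℚ.≤ m)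

Density : (d : ℕ) (D : Tree) (n : ℕ) → Pred ℚ 0ℓ
Density d D n q = ∃[ T ] IsDAry d T × ‖ T ‖ ≡ n × γ D T ≡ q

IsLimSup : (ℕ → ℚ) → ℚ → Set
IsLimSup a L =
  (∀ ε → 0ℚ ℚ.< ε → ∃[ N ] (∀ n → N ℕ.≤ n → a n ℚ.< L ℚ.+ ε)) ×
  (∀ ε → 0ℚ ℚ.< ε → ∀ N → ∃[ n ] N ℕ.≤ n × L ℚ.- ε ℚ.< a n)

-- I_d(D) = L.  There is no tree with 0 leaves, so the value a 0 is arbitrary.

Inducibility : (d : ℕ) (D : Tree) → ℚ → Set
Inducibility d D L =
  Σ (ℕ → ℚ) λ a → (∀ n → 1 ℕ.≤ n → IsMaximum (Density d D n) (a n)) × IsLimSup a L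

-- IsEven d k T: the tree T is E_k^d.

data IsEven (d : ℕ) : ℕ → Tree → Set where
  single : IsEven d 1 leaf
  star   : ∀ {k} → 2 ℕ.≤ k → k ℕ.≤ d → IsEven d k (node (replicate k leaf))
  branch : ∀ {s b T U} → b ℕ.< d → d ℕ.< d ℕ.* s ℕ.+ b →
           IsEven d s T → IsEven d (suc s) U →
           IsEven d (d ℕ.* s ℕ.+ b) (node (replicate (d ℕ.∸ b) T ++ replicate b U))

record IsEvenConstants (d : ℕ) (c : ℕ → ℚ) : Set where
  field
    c₀    : c 0 ≡ 1ℚ
    c₁    : c 1 ≡ 1ℚ
    c-rec : ∀ s b → b ℕ.< d → 2 ℕ.≤ d ℕ.* s ℕ.+ b →
            c (d ℕ.* s ℕ.+ b) ≡
            fromℕ (d C b) ℚ.*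
              ((c s ^ℚ (d ℕ.∸ b) ℚ.* c (suc s) ^ℚ b) ÷₀
               (fromℕ d ^ℚ (d ℕ.* s ℕ.+ b) ℚ.- fromℕ d))

{-# OPTIONS --safe #-}

-- The copies of E_k in a tree X with branches of sizes x₁, …, x_d lie either in
-- one branch or, s or s + 1 leaves at a time, in all of them, which gives a
-- recursion for their number.  By induction on k and X, at most c_k ‖ X ‖ ^ k
-- copies exist as soon as, for k = d s + b,
--   Σ xᵢ^k + (d^k - d) M ≤ (Σ xᵢ)^k,
-- where M is the mean of the monomials with exponents s (d - b times) and s + 1
-- (b times).  This holds because the right side minus Σ xᵢ^k is a sum of d^k - d
-- monomials of degree k, whose means over all permutations of the variables are
-- at least M, the exponents of M being as equal as possible.  For complete
-- d-ary trees all xᵢ are equal, so the bound is attained up to lower order terms.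

module Submission where

open import Defs
open import Data.Bool using (if_then_else_)
open import Data.Fin.Subset using (Subset; inside; outside; ∣_∣)
open import Data.List using (List; []; _∷_; _++_; _∷ʳ_; length; map; filter; replicate; cartesianProductWith)
open import Data.List.Membership.Propositional.Properties using (∈-cartesianProductWith⁺; ∈-map⁺; ∈-filter⁺)
open import Data.List.Properties
  using (++-assoc; ++-identityʳ; length-replicate; length-++; length-map; map-++; map-∘; map-cong; map-replicate)
open import Data.List.Relation.Binary.Permutation.Homogeneous as Homogeneous using (Permutation; prep; swap)
open import Data.List.Relation.Binary.Permutation.Propositional
  using (refl; prep; swap) renaming (_↭_ to _↭ℕ_; trans to transℕ; ↭-sym to ↭ℕ-sym)
open import Data.List.Relation.Binary.Permutation.Propositional.Properties
  using (∷↭∷ʳ; ↭-length; ++-comm; All-resp-↭) renaming (shift to shiftℕ)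
open import Data.List.Relation.Binary.Pointwise using (Pointwise; []; _∷_)
open import Data.List.Relation.Unary.All as All using (All; []; _∷_)
open import Data.List.Relation.Unary.All.Properties using (++⁺; replicate⁺; all-filter)
open import Data.List.Relation.Unary.Any using (here; there)
open import Data.Maybe using (Maybe; just; nothing)
open import Data.Nat
open import Data.Nat.Combinatorics using (_C_; nCk≡n!/k![n-k]!; k![n∸k]!∣n!; nCn≡1)
open import Data.Nat.Combinatorics.Base using (_P′_)
open import Data.Nat.Combinatorics.Specification using (nP′k≡n!/[n∸k]!)
open import Data.Nat.Coprimality as Coprimality using (1-coprimeTo)
open import Data.Nat.Divisibility using (∣-trans; n∣m*n)
open import Data.Nat.DivMod using (m/n*n≡m)
open import Data.Nat.ListAction using (sum)
open import Data.Nat.ListAction.Properties using (sum-↭; sum-++)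
open import Data.Nat.Properties
open import Data.Nat.Tactic.RingSolver using (solve-∀)
open import Data.Product as Product using (_×_; _,_; ∃-syntax; Σ-syntax; proj₁; proj₂)
open import Data.Rational as ℚ using (ℚ; mkℚ; 0ℚ; 1ℚ; toℚᵘ)
open import Data.Rational.Solver using (module +-*-Solver)
open import Data.Sum using (_⊎_; inj₁; inj₂)
open import Data.Vec using ([]; _∷_; take; drop)
open import Function using (_∘_; const; case_of_)
open import Relation.Binary using (DecTotalOrder)
open import Relation.Binary.PropositionalEquality
  using (_≡_; _≢_; refl; sym; trans; cong; cong₂; subst; subst₂; module ≡-Reasoning)
open import Relation.Nullary using (Dec; yes; no; does; ¬_; contradiction)
open import Relation.Nullary.Decidable using (map′; _×-dec_)
import Data.Integer as ℤ
import Data.Integer.Properties as ℤ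
import Data.List.Membership.Propositional as ListMembership
import Data.List.Membership.Setoid as SetoidMembership
import Data.List.Relation.Binary.Permutation.Setoid as SetoidPermutation
import Data.List.Relation.Binary.Permutation.Setoid.Properties as PermutationProperties
import Data.Rational.Properties as ℚ
import Data.Rational.Unnormalised as ℚᵘ
import Data.Rational.Unnormalised.Properties as ℚᵘ

open import Data.List.Extrema (DecTotalOrder.totalOrder ℚ.≤-decTotalOrder) using (argmax; argmax-all; f[xs]≤f[argmax])
open ListMembership using (_∈_)
open PermutationProperties ≅-setoid using (∈-resp-↭; drop-∷; shift; xs↭ys⇒|xs|≡|ys|)
open SetoidMembership ≅-setoid using () renaming (_∈_ to _∈≅_)
open SetoidPermutation ≅-setoid using (_↭_; ↭-sym; ↭-trans; ↭-refl)

-- The constants are dictated by complete trees. If such a tree with n leaves has about c n^k copies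
-- of E_k, one more level turns this into d c n^k copies inside single branches and (d choose b)
-- c_s^(d-b) c_{s+1}^b n^k copies spread over the branches. Equating the total with c (d n)^k gives
-- c = c_k. That M is the smallest mean is Muirhead's inequality for special exponents, obtained one
-- unit of degree at a time: multiplying by Σ xᵢ raises every exponent in turn, so raising a
-- smallest exponent multiplies a symmetric sum by at most the mean of the xᵢ, and raising a largest
-- one by at least that mean. The delicate point of the lower bound is the error K n^(k-1). One
-- level may enlarge it by the factor d^(k-1), but the d branches already use up a factor d. For k ≥
-- 3 the difference absorbs the new errors of the product; for k = 2 there is no room, but the
-- branches are then single leaves, whose counts are exact. All bounds are between natural numbers
-- with denominators cleared; rationals enter only for the values c_k and the limit.

-- Symmetric sums

-- Sel f xs is the sum of f y ys over all ways of removing one entry y from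
-- xs, ys being the list of the remaining entries.
Sel : (ℕ → List ℕ → ℕ) → List ℕ → ℕ
Sel f []       = 0
Sel f (x ∷ xs) = f x xs + Sel (λ y ys → f y (x ∷ ys)) xs

-- The monomial symmetric sum Σ x_{i₁}^{a₁} ⋯ x_{iₘ}^{aₘ} over distinct
-- indices i₁, …, iₘ.
S : List ℕ → List ℕ → ℕ
S []      xs = 1
S (a ∷ α) xs = Sel (λ y ys → y ^ a * S α ys) xs

Sel-mono : ∀ {f g} xs → (∀ y ys → y ∷ ys ↭ℕ xs → f y ys ≤ g y ys) → Sel f xs ≤ Sel g xs
Sel-mono []       h = z≤n
Sel-mono (x ∷ xs) h =
  +-mono-≤ (h x xs refl) (Sel-mono xs λ y ys p → h y (x ∷ ys) (transℕ (swap y x refl) (prep x p)))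

Sel-cong : ∀ {f g} xs → (∀ y ys → y ∷ ys ↭ℕ xs → f y ys ≡ g y ys) → Sel f xs ≡ Sel g xs
Sel-cong xs h =
  ≤-antisym (Sel-mono xs λ y ys p → ≤-reflexive (h y ys p))
            (Sel-mono xs λ y ys p → ≤-reflexive (sym (h y ys p)))

private
  interchange : ∀ a b c d → (a + b) + (c + d) ≡ (a + c) + (b + d)
  interchange = solve-∀

Sel-+ : ∀ f g xs → Sel (λ y ys → f y ys + g y ys) xs ≡ Sel f xs + Sel g xs
Sel-+ f g []       = refl
Sel-+ f g (x ∷ xs)
  rewrite Sel-+ (λ y ys → f y (x ∷ ys)) (λ y ys → g y (x ∷ ys)) xs =
  interchange (f x xs) (g x xs) _ _

Sel-*ˡ : ∀ c f xs → Sel (λ y ys → c * f y ys) xs ≡ c * Sel f xs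
Sel-*ˡ c f []       = sym (*-zeroʳ c)
Sel-*ˡ c f (x ∷ xs) rewrite Sel-*ˡ c (λ y ys → f y (x ∷ ys)) xs =
  sym (*-distribˡ-+ c (f x xs) _)

Sel-const : ∀ c xs → Sel (λ _ _ → c) xs ≡ length xs * c
Sel-const c []       = refl
Sel-const c (x ∷ xs) = cong (c +_) (Sel-const c xs)

-- The remaining entries keep their order, so removing two entries in either order leaves the same
-- list. The symmetry of `S` in its exponents rests on this.
Sel-swap : ∀ (f : ℕ → ℕ → List ℕ → ℕ) xs →
           Sel (λ y → Sel (f y)) xs ≡ Sel (λ y → Sel (λ z → f z y)) xs
Sel-swap f []       = refl
Sel-swap f (x ∷ xs) = begin
  Sel (f x) xs + Sel (λ y ys → f y x ys + Sel (λ z zs → f y z (x ∷ zs)) ys) xs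
    ≡⟨ cong (Sel (f x) xs +_) (Sel-+ (λ y → f y x) (λ y → Sel (λ z zs → f y z (x ∷ zs))) xs) ⟩
  Sel (f x) xs + (Sel (λ y → f y x) xs + Sel (λ y → Sel (λ z zs → f y z (x ∷ zs))) xs)
    ≡⟨ exch (Sel (f x) xs) (Sel (λ y → f y x) xs) (Sel (λ y → Sel (λ z zs → f y z (x ∷ zs))) xs) ⟩
  Sel (λ y → f y x) xs + (Sel (f x) xs + Sel (λ y → Sel (λ z zs → f y z (x ∷ zs))) xs)
    ≡⟨ cong (λ r → Sel (λ y → f y x) xs + (Sel (f x) xs + r)) (Sel-swap (λ y z zs → f y z (x ∷ zs)) xs) ⟩
  Sel (λ y → f y x) xs + (Sel (f x) xs + Sel (λ y → Sel (λ z zs → f z y (x ∷ zs))) xs)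
    ≡⟨ cong (Sel (λ y → f y x) xs +_) (sym (Sel-+ (f x) (λ y → Sel (λ z zs → f z y (x ∷ zs))) xs)) ⟩
  Sel (λ y → f y x) xs + Sel (λ y ys → f x y ys + Sel (λ z zs → f z y (x ∷ zs)) ys) xs ∎
  where
  open ≡-Reasoning
  exch : ∀ a b c → a + (b + c) ≡ b + (a + c)
  exch = solve-∀

S-∷∷ : ∀ a b α xs →
       S (a ∷ b ∷ α) xs ≡ Sel (λ y → Sel (λ z zs → y ^ a * (z ^ b * S α zs))) xs
S-∷∷ a b α xs = Sel-cong xs λ y ys _ → sym (Sel-*ˡ (y ^ a) _ ys)

S-swap : ∀ a b α xs → S (a ∷ b ∷ α) xs ≡ S (b ∷ a ∷ α) xs
S-swap a b α xs = begin
  S (a ∷ b ∷ α) xs                                             ≡⟨ S-∷∷ a b α xs ⟩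
  Sel (λ y → Sel (λ z zs → y ^ a * (z ^ b * S α zs))) xs       ≡⟨ Sel-swap (λ y z zs → y ^ a * (z ^ b * S α zs)) xs ⟩
  Sel (λ y → Sel (λ z zs → z ^ a * (y ^ b * S α zs))) xs
    ≡⟨ Sel-cong xs (λ y ys _ → Sel-cong ys λ z zs _ → exch (z ^ a) (y ^ b) (S α zs)) ⟩
  Sel (λ y → Sel (λ z zs → y ^ b * (z ^ a * S α zs))) xs       ≡⟨ sym (S-∷∷ b a α xs) ⟩
  S (b ∷ a ∷ α) xs                                             ∎
  where
  open ≡-Reasoning
  exch : ∀ a b c → a * (b * c) ≡ b * (a * c)
  exch = solve-∀

S-↭ : ∀ {α β} → α ↭ℕ β → ∀ xs → S α xs ≡ S β xs
S-↭ refl                     xs = refl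
S-↭ (prep a p)               xs = Sel-cong xs λ y ys _ → cong (y ^ a *_) (S-↭ p ys)
S-↭ (swap {ys = β} a b p)    xs =
  trans (Sel-cong xs λ y ys _ → cong (y ^ a *_) (Sel-cong ys λ z zs _ → cong (z ^ b *_) (S-↭ p zs)))
          (S-swap a b β xs)
S-↭ (transℕ p q)              xs = trans (S-↭ p xs) (S-↭ q xs)

-- With `z = y + o` the right side exceeds the left one by `o * (z ^ e - y ^ e)`.
rearrangement-≤ : ∀ e {y z} → y ≤ z → y * z ^ e + z * y ^ e ≤ z ^ suc e + y ^ suc e
rearrangement-≤ e {y} {z} y≤z with m≤n⇒∃[o]m+o≡n y≤z
... | o , refl = begin
  y * (y + o) ^ e + (y + o) * y ^ e               ≡⟨ cong (y * (y + o) ^ e +_) (*-distribʳ-+ (y ^ e) y o) ⟩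
  y * (y + o) ^ e + (y * y ^ e + o * y ^ e)
    ≤⟨ +-monoʳ-≤ (y * (y + o) ^ e) (+-monoʳ-≤ (y * y ^ e) (*-monoʳ-≤ o (^-monoˡ-≤ e (m≤m+n y o)))) ⟩
  y * (y + o) ^ e + (y * y ^ e + o * (y + o) ^ e) ≡⟨ regroup y o ((y + o) ^ e) (y * y ^ e) ⟩
  (y + o) * (y + o) ^ e + y * y ^ e               ∎
  where
  open ≤-Reasoning
  regroup : ∀ y o p q → y * p + (q + o * p) ≡ (y + o) * p + q
  regroup = solve-∀

rearrangement : ∀ e y z → y * z ^ e + z * y ^ e ≤ z ^ suc e + y ^ suc e
rearrangement e y z with ≤-total y z
... | inj₁ y≤z = rearrangement-≤ e y≤z
... | inj₂ z≤y = begin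
  y * z ^ e + z * y ^ e ≡⟨ +-comm (y * z ^ e) _ ⟩
  z * y ^ e + y * z ^ e ≤⟨ rearrangement-≤ e z≤y ⟩
  y ^ suc e + z ^ suc e ≡⟨ +-comm (y ^ suc e) _ ⟩
  z ^ suc e + y ^ suc e ∎
  where open ≤-Reasoning

-- With `b = c + e` both sides have the factor `y ^ c * z ^ c * w`; what remains is `rearrangement`.
smoothing₂ : ∀ {c b} → c ≤ b → ∀ y z w →
             y ^ suc c * (z ^ b * w) + z ^ suc c * (y ^ b * w) ≤
             y ^ c * (z ^ suc b * w) + z ^ c * (y ^ suc b * w)
smoothing₂ {c} c≤b y z w with m≤n⇒∃[o]m+o≡n c≤b
... | e , refl = begin
  y ^ suc c * (z ^ (c + e) * w) + z ^ suc c * (y ^ (c + e) * w)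
    ≡⟨ cong₂ (λ p q → y ^ suc c * (p * w) + z ^ suc c * (q * w)) (^-distribˡ-+-* z c e) (^-distribˡ-+-* y c e) ⟩
  y * y ^ c * (z ^ c * z ^ e * w) + z * z ^ c * (y ^ c * y ^ e * w)
    ≡⟨ factor y z (y ^ c) (z ^ c) (y ^ e) (z ^ e) w ⟩
  (y ^ c * z ^ c * w) * (y * z ^ e + z * y ^ e)
    ≤⟨ *-monoʳ-≤ (y ^ c * z ^ c * w) (rearrangement e y z) ⟩
  (y ^ c * z ^ c * w) * (z * z ^ e + y * y ^ e)
    ≡⟨ expand y z (y ^ c) (z ^ c) (y ^ e) (z ^ e) w ⟩
  y ^ c * (z * (z ^ c * z ^ e) * w) + z ^ c * (y * (y ^ c * y ^ e) * w)
    ≡⟨ sym (cong₂ (λ p q → y ^ c * (z * p * w) + z ^ c * (y * q * w)) (^-distribˡ-+-* z c e) (^-distribˡ-+-* y c e)) ⟩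
  y ^ c * (z ^ suc (c + e) * w) + z ^ c * (y ^ suc (c + e) * w) ∎
  where
  open ≤-Reasoning
  factor : ∀ y z yc zc ye ze w →
           y * yc * (zc * ze * w) + z * zc * (yc * ye * w) ≡ (yc * zc * w) * (y * ze + z * ye)
  factor = solve-∀
  expand : ∀ y z yc zc ye ze w →
           (yc * zc * w) * (z * ze + y * ye) ≡ yc * (z * (zc * ze) * w) + zc * (y * (yc * ye) * w)
  expand = solve-∀

2m≤2n⇒m≤n : ∀ {m n} → m + m ≤ n + n → m ≤ n
2m≤2n⇒m≤n {m} {n} h with ≤-total m n
... | inj₁ m≤n = m≤n
... | inj₂ n≤m = +-cancelˡ-≤ m m n (≤-trans h (+-monoˡ-≤ n n≤m))

-- The sums over ordered pairs of distinct indices are compared after being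
-- symmetrised.
S-smoothing : ∀ {c b} → c ≤ b → ∀ α xs → S (suc c ∷ b ∷ α) xs ≤ S (c ∷ suc b ∷ α) xs
S-smoothing {c} {b} c≤b α xs = 2m≤2n⇒m≤n (begin
  S (suc c ∷ b ∷ α) xs + S (suc c ∷ b ∷ α) xs ≡⟨ double (suc c) b ⟩
  sym₂ (suc c) b                              ≤⟨ Sel-mono xs (λ y ys _ → Sel-mono ys λ z zs _ → smoothing₂ c≤b y z (S α zs)) ⟩
  sym₂ c (suc b)                              ≡⟨ double c (suc b) ⟨
  S (c ∷ suc b ∷ α) xs + S (c ∷ suc b ∷ α) xs ∎)
  where
  open ≤-Reasoning
  mono : ℕ → ℕ → ℕ → ℕ → List ℕ → ℕ
  mono a b y z zs = y ^ a * (z ^ b * S α zs)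
  sym₂ : ℕ → ℕ → ℕ
  sym₂ a b = Sel (λ y → Sel (λ z zs → mono a b y z zs + mono a b z y zs)) xs
  double : ∀ a b → S (a ∷ b ∷ α) xs + S (a ∷ b ∷ α) xs ≡ sym₂ a b
  double a b = trans
    (cong₂ _+_ (S-∷∷ a b α xs) (trans (S-∷∷ a b α xs) (Sel-swap (mono a b) xs)))
    (trans (sym (Sel-+ _ _ xs)) (Sel-cong xs λ y ys _ → sym (Sel-+ _ _ ys)))

-- The sum of f over the exponent lists obtained from α 0 by adding one to one
-- of the entries.
Inc : (List ℕ → ℕ) → List ℕ → ℕ
Inc f []      = f (1 ∷ [])
Inc f (a ∷ α) = f (suc a ∷ α) + Inc (λ β → f (a ∷ β)) α

Inc-cong : ∀ {f g} α → (∀ β → f β ≡ g β) → Inc f α ≡ Inc g α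
Inc-cong []      h = h _
Inc-cong (a ∷ α) h = cong₂ _+_ (h _) (Inc-cong α λ β → h (a ∷ β))

Inc-Sel : ∀ (g : ℕ → List ℕ → List ℕ → ℕ) α xs →
          Inc (λ β → Sel (λ y ys → g y ys β) xs) α ≡ Sel (λ y ys → Inc (g y ys) α) xs
Inc-Sel g []      xs = refl
Inc-Sel g (a ∷ α) xs =
  trans (cong (Sel (λ y ys → g y ys (suc a ∷ α)) xs +_) (Inc-Sel (λ y ys β → g y ys (a ∷ β)) α xs))
          (sym (Sel-+ _ _ xs))

Inc-*ˡ : ∀ c f α → Inc (λ β → c * f β) α ≡ c * Inc f α
Inc-*ˡ c f []      = refl
Inc-*ˡ c f (a ∷ α) = trans (cong (c * f (suc a ∷ α) +_) (Inc-*ˡ c (λ β → f (a ∷ β)) α))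
                             (sym (*-distribˡ-+ c (f (suc a ∷ α)) _))

S-singleton : ∀ k xs → S (k ∷ []) xs ≡ sum (map (_^ k) xs)
S-singleton k []       = refl
S-singleton k (x ∷ xs) = cong₂ _+_ (*-identityʳ (x ^ k)) (S-singleton k xs)

map-^1 : ∀ xs → sum (map (_^ 1) xs) ≡ sum xs
map-^1 []       = refl
map-^1 (x ∷ xs) = cong₂ _+_ (*-identityʳ x) (map-^1 xs)

-- The selected entry `y` splits `sum xs` into `y`, which raises the first exponent, and the sum of
-- the other entries, which the recursion distributes over the other exponents. When no exponent is
-- left, the factor becomes a further exponent 1.
sum*S : ∀ α xs → sum xs * S α xs ≡ Inc (λ β → S β xs) α
sum*S []      xs = trans (*-identityʳ _) (trans (sym (map-^1 xs)) (sym (S-singleton 1 xs)))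
sum*S (a ∷ α) xs = begin
  sum xs * S (a ∷ α) xs
    ≡⟨ sym (Sel-*ˡ (sum xs) _ xs) ⟩
  Sel (λ y ys → sum xs * (y ^ a * S α ys)) xs
    ≡⟨ Sel-cong xs (λ y ys p → trans (cong (_* (y ^ a * S α ys)) (sym (sum-↭ p)))
                                (trans (distr y (sum ys) (y ^ a) (S α ys))
                                         (cong (λ r → y ^ suc a * S α ys + y ^ a * r) (sum*S α ys)))) ⟩
  Sel (λ y ys → y ^ suc a * S α ys + y ^ a * Inc (λ β → S β ys) α) xs
    ≡⟨ Sel-+ _ _ xs ⟩
  S (suc a ∷ α) xs + Sel (λ y ys → y ^ a * Inc (λ β → S β ys) α) xs
    ≡⟨ cong (S (suc a ∷ α) xs +_)
         (trans (Sel-cong xs λ y ys _ → sym (Inc-*ˡ (y ^ a) (λ β → S β ys) α))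
                  (sym (Inc-Sel (λ y ys β → y ^ a * S β ys) α xs))) ⟩
  S (suc a ∷ α) xs + Inc (λ β → S (a ∷ β) xs) α ∎
  where
  open ≡-Reasoning
  distr : ∀ y t p s → (y + t) * (p * s) ≡ y * p * s + p * (t * s)
  distr = solve-∀

S-too-long : ∀ α xs → length xs < length α → S α xs ≡ 0
S-too-long (a ∷ α) xs (s≤s len) =
  trans (Sel-cong xs λ y ys p →
             trans (cong (y ^ a *_) (S-too-long α ys (subst (_≤ _) (sym (↭-length p)) len)))
                     (*-zeroʳ (y ^ a)))
          (trans (Sel-const 0 xs) (*-zeroʳ (length xs)))

private
  shifted : ∀ a b (γ δ : List ℕ) → a ∷ γ ++ b ∷ δ ↭ℕ a ∷ b ∷ γ ++ δ
  shifted a b γ δ = prep a (shiftℕ b γ δ)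

-- `γ` collects the exponents already passed. Raising an entry `b` of `δ` instead of the smaller `c`
-- can only increase the sum, by `S-smoothing`. The last term of `Inc`, with a new exponent 1, is
-- dropped.
Inc-lower : ∀ c γ δ xs → All (c ≤_) δ →
            length δ * S (suc c ∷ γ ++ δ) xs ≤ Inc (λ β → S (c ∷ γ ++ β) xs) δ
Inc-lower c γ []      xs []           = z≤n
Inc-lower c γ (b ∷ δ) xs (c≤b ∷ c≤δ)  = +-mono-≤
  (begin
    S (suc c ∷ γ ++ b ∷ δ) xs     ≡⟨ S-↭ (shifted (suc c) b γ δ) xs ⟩
    S (suc c ∷ b ∷ γ ++ δ) xs     ≤⟨ S-smoothing c≤b (γ ++ δ) xs ⟩
    S (c ∷ suc b ∷ γ ++ δ) xs     ≡⟨ S-↭ (shifted c (suc b) γ δ) xs ⟨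
    S (c ∷ γ ++ suc b ∷ δ) xs     ∎)
  (begin
    length δ * S (suc c ∷ γ ++ b ∷ δ) xs         ≡⟨ cong (λ r → length δ * S (suc c ∷ r) xs) (++-assoc γ (b ∷ []) δ) ⟨
    length δ * S (suc c ∷ (γ ∷ʳ b) ++ δ) xs      ≤⟨ Inc-lower c (γ ∷ʳ b) δ xs c≤δ ⟩
    Inc (λ β → S (c ∷ (γ ∷ʳ b) ++ β) xs) δ       ≡⟨ Inc-cong δ (λ β → cong (λ r → S (c ∷ r) xs) (++-assoc γ (b ∷ []) β)) ⟩
    Inc (λ β → S (c ∷ γ ++ b ∷ β) xs) δ          ∎)
  where open ≤-Reasoning

-- The factor `sum xs` raises each of the `length xs` exponents in turn, and raising the smallest
-- one gives the least.
S-raise-min : ∀ c β xs → All (c ≤_) β → suc (length β) ≡ length xs →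
              length xs * S (suc c ∷ β) xs ≤ sum xs * S (c ∷ β) xs
S-raise-min c β xs c≤β len = begin
  length xs * S (suc c ∷ β) xs                              ≡⟨ cong (_* S (suc c ∷ β) xs) len ⟨
  S (suc c ∷ β) xs + length β * S (suc c ∷ β) xs            ≤⟨ +-monoʳ-≤ (S (suc c ∷ β) xs) (Inc-lower c [] β xs c≤β) ⟩
  Inc (λ γ → S γ xs) (c ∷ β)                                ≡⟨ sum*S (c ∷ β) xs ⟨
  sum xs * S (c ∷ β) xs                                     ∎
  where open ≤-Reasoning

-- Mirror image of `Inc-lower`. The term with a new exponent 1 must now be bounded from above; it
-- vanishes because `c ∷ γ ++ δ` already uses up all entries of `xs`.
Inc-upper : ∀ c γ δ xs → All (_≤ c) δ → length xs ≡ suc (length (γ ++ δ)) →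
            Inc (λ β → S (c ∷ γ ++ β) xs) δ ≤ length δ * S (suc c ∷ γ ++ δ) xs
Inc-upper c γ []      xs []          len = ≤-reflexive (S-too-long (c ∷ γ ++ 1 ∷ []) xs (begin-strict
  length xs                          ≡⟨ len ⟩
  suc (length (γ ++ []))             ≡⟨ cong (λ r → suc (length r)) (++-identityʳ γ) ⟩
  suc (length γ)                     <⟨ n<1+n _ ⟩
  suc (suc (length γ))               ≡⟨ ↭-length (prep c (∷↭∷ʳ 1 γ)) ⟩
  suc (length (γ ++ 1 ∷ []))         ∎))
  where
  open ≤-Reasoning
Inc-upper c γ (b ∷ δ) xs (b≤c ∷ δ≤c) len = +-mono-≤
  (begin
    S (c ∷ γ ++ suc b ∷ δ) xs     ≡⟨ S-↭ (shifted c (suc b) γ δ) xs ⟩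
    S (c ∷ suc b ∷ γ ++ δ) xs     ≡⟨ S-swap c (suc b) (γ ++ δ) xs ⟩
    S (suc b ∷ c ∷ γ ++ δ) xs     ≤⟨ S-smoothing b≤c (γ ++ δ) xs ⟩
    S (b ∷ suc c ∷ γ ++ δ) xs     ≡⟨ S-swap b (suc c) (γ ++ δ) xs ⟩
    S (suc c ∷ b ∷ γ ++ δ) xs     ≡⟨ S-↭ (shifted (suc c) b γ δ) xs ⟨
    S (suc c ∷ γ ++ b ∷ δ) xs     ∎)
  (begin
    Inc (λ β → S (c ∷ γ ++ b ∷ β) xs) δ          ≡⟨ Inc-cong δ (λ β → cong (λ r → S (c ∷ r) xs) (++-assoc γ (b ∷ []) β)) ⟨
    Inc (λ β → S (c ∷ (γ ∷ʳ b) ++ β) xs) δ       ≤⟨ Inc-upper c (γ ∷ʳ b) δ xs δ≤c (trans len (cong (λ r → suc (length r)) (sym (++-assoc γ (b ∷ []) δ)))) ⟩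
    length δ * S (suc c ∷ (γ ∷ʳ b) ++ δ) xs      ≡⟨ cong (λ r → length δ * S (suc c ∷ r) xs) (++-assoc γ (b ∷ []) δ) ⟩
    length δ * S (suc c ∷ γ ++ b ∷ δ) xs         ∎)
  where open ≤-Reasoning

S-raise-max : ∀ c β xs → All (_≤ c) β → suc (length β) ≡ length xs →
              sum xs * S (c ∷ β) xs ≤ length xs * S (suc c ∷ β) xs
S-raise-max c β xs β≤c len = begin
  sum xs * S (c ∷ β) xs                                     ≡⟨ sum*S (c ∷ β) xs ⟩
  Inc (λ γ → S γ xs) (c ∷ β)                                ≤⟨ +-monoʳ-≤ (S (suc c ∷ β) xs) (Inc-upper c [] β xs β≤c (sym len)) ⟩
  S (suc c ∷ β) xs + length β * S (suc c ∷ β) xs            ≡⟨ cong (_* S (suc c ∷ β) xs) len ⟩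
  length xs * S (suc c ∷ β) xs                              ∎
  where open ≤-Reasoning

-- The zero exponents merely put the `m` entries not selected by `α` in some order.
S-++zeros : ∀ α m xs → length xs ≡ length α + m → S (α ++ replicate m 0) xs ≡ m ! * S α xs
S-++zeros []      zero    xs len = refl
S-++zeros []      (suc m) xs len = begin
  Sel (λ y ys → 1 * S (replicate m 0) ys) xs
    ≡⟨ Sel-cong xs (λ y ys p → trans (*-identityˡ _)
         (trans (S-++zeros [] m ys (suc-injective (trans (↭-length p) len))) (*-identityʳ (m !)))) ⟩
  Sel (λ y ys → m !) xs  ≡⟨ Sel-const (m !) xs ⟩
  length xs * m !        ≡⟨ cong (_* m !) len ⟩
  suc m !                ≡⟨ *-identityʳ (suc m !) ⟨
  suc m ! * 1            ∎
  where open ≡-Reasoning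
S-++zeros (a ∷ α) m xs len = trans
  (Sel-cong xs λ y ys p →
    trans (cong (y ^ a *_) (S-++zeros α m ys (suc-injective (trans (↭-length p) len))))
            (exch (y ^ a) (m !) (S α ys)))
  (Sel-*ˡ (m !) _ xs)
  where
  exch : ∀ a b c → a * (b * c) ≡ b * (a * c)
  exch = solve-∀

-- flat d k distributes k as evenly as possible over d exponents: going round,
-- the smallest exponent is raised and moved to the end.
flat : ℕ → ℕ → List ℕ
flat d zero    = replicate d 0
flat d (suc k) = next (flat d k)
  where
  next : List ℕ → List ℕ
  next []      = []
  next (a ∷ α) = α ∷ʳ suc a

replicate-∷ʳ : ∀ q (a : ℕ) → replicate q a ∷ʳ a ≡ replicate (suc q) a
replicate-∷ʳ zero    a = refl
replicate-∷ʳ (suc q) a = cong (a ∷_) (replicate-∷ʳ q a)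

even : ℕ → ℕ → ℕ → List ℕ
even p q s = replicate p s ++ replicate q (suc s)

even-∷ʳ : ∀ p q s → even p q s ∷ʳ suc s ≡ even p (suc q) s
even-∷ʳ p q s = trans (++-assoc (replicate p s) _ _) (cong (replicate p s ++_) (replicate-∷ʳ q (suc s)))

flat-suc : ∀ d k p q s → flat d k ≡ even (suc p) q s → flat d (suc k) ≡ even p (suc q) s
flat-suc d k p q s eq rewrite eq = even-∷ʳ p q s

even-wrap : ∀ q s → even 0 q s ≡ even q 0 (suc s)
even-wrap q s = sym (++-identityʳ (replicate q (suc s)))

flat-form : ∀ e k → ∃[ p ] ∃[ q ] ∃[ s ] p + q ≡ e × flat (suc e) k ≡ even (suc p) q s
flat-form e zero = e , 0 , 0 , +-identityʳ e , cong (0 ∷_) (sym (++-identityʳ (replicate e 0)))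
flat-form e (suc k) with flat-form e k
... | suc p , q , s , len , eq = p , suc q , s , trans (+-suc p q) len , flat-suc (suc e) k (suc p) q s eq
... | zero  , q , s , len , eq = q , 0 , suc s , trans (+-identityʳ q) len ,
  trans (flat-suc (suc e) k 0 q s eq) (even-wrap (suc q) s)

flat-even : ∀ d p q s → p + q ≡ d → flat d (q + d * s) ≡ even p q s
flat-even d p zero zero len rewrite *-zeroʳ d | +-identityʳ p | len = sym (++-identityʳ (replicate d 0))
flat-even d p zero (suc s) len = begin
  flat d (d * suc s)  ≡⟨ cong (flat d) (*-suc d s) ⟩
  flat d (d + d * s)  ≡⟨ flat-even d 0 d s refl ⟩
  even 0 d s          ≡⟨ even-wrap d s ⟩
  even d 0 (suc s)    ≡⟨ cong (λ r → even r 0 (suc s)) (trans (sym len) (+-identityʳ p)) ⟩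
  even p 0 (suc s)    ∎
  where open ≡-Reasoning
flat-even d p (suc q) s len =
  flat-suc d (q + d * s) p q s (flat-even d (suc p) q s (trans (sym (+-suc p q)) len))

even-min : ∀ p q s → All (s ≤_) (even p q s)
even-min p q s = ++⁺ (replicate⁺ p ≤-refl) (replicate⁺ q (n≤1+n s))

length-even : ∀ p q s → length (even p q s) ≡ p + q
length-even p q s = trans (length-++ (replicate p s)) (cong₂ _+_ (length-replicate p) (length-replicate q))

-- The head of `flat` is always a smallest exponent, and it is the one raised next, so `S-raise-min`
-- applies.
S-flat-suc : ∀ k xs → length xs * S (flat (length xs) (suc k)) xs ≤ sum xs * S (flat (length xs) k) xs
S-flat-suc k []         = z≤n
S-flat-suc k xs@(_ ∷ t) with flat-form (length t) k
... | p , q , s , len , eq = begin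
  length xs * S (flat (length xs) (suc k)) xs
    ≡⟨ cong (λ α → length xs * S α xs) (trans (flat-suc (length xs) k p q s eq) (sym (even-∷ʳ p q s))) ⟩
  length xs * S (even p q s ∷ʳ suc s) xs
    ≡⟨ cong (length xs *_) (S-↭ (↭ℕ-sym (∷↭∷ʳ (suc s) (even p q s))) xs) ⟩
  length xs * S (suc s ∷ even p q s) xs
    ≤⟨ S-raise-min s (even p q s) xs (even-min p q s) (cong suc (trans (length-even p q s) len)) ⟩
  sum xs * S (even (suc p) q s) xs
    ≡⟨ cong (λ α → sum xs * S α xs) eq ⟨
  sum xs * S (flat (length xs) k) xs ∎
  where open ≤-Reasoning

-- Both lists grow together: one more unit multiplies the flat sum by at most the mean of `xs`
-- (`S-flat-suc`) and the other sum by at least that mean (`S-raise-max`). In degree 2 the lists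
-- agree up to order.
S-flat-minimal : ∀ e k xs → length xs ≡ 2 + e →
                 S (flat (2 + e) (2 + k)) xs ≤ S (suc k ∷ 1 ∷ replicate e 0) xs
S-flat-minimal e zero xs len = ≤-reflexive (S-↭ rotate₂ xs)
  where
  rotate₂ : flat (2 + e) 2 ↭ℕ 1 ∷ 1 ∷ replicate e 0
  rotate₂ = transℕ (↭ℕ-sym (∷↭∷ʳ 1 _)) (prep 1 (↭ℕ-sym (∷↭∷ʳ 1 _)))
S-flat-minimal e (suc k) xs len = *-cancelˡ-≤ (2 + e) (begin
  (2 + e) * S (flat (2 + e) (3 + k)) xs       ≡⟨ cong (λ d → d * S (flat d (3 + k)) xs) len ⟨
  length xs * S (flat (length xs) (3 + k)) xs ≤⟨ S-flat-suc (2 + k) xs ⟩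
  sum xs * S (flat (length xs) (2 + k)) xs    ≡⟨ cong (λ d → sum xs * S (flat d (2 + k)) xs) len ⟩
  sum xs * S (flat (2 + e) (2 + k)) xs        ≤⟨ *-monoʳ-≤ (sum xs) (S-flat-minimal e k xs len) ⟩
  sum xs * S (suc k ∷ 1 ∷ replicate e 0) xs
    ≤⟨ S-raise-max (suc k) (1 ∷ replicate e 0) xs (s≤s z≤n ∷ replicate⁺ e z≤n)
         (trans (cong (2 +_) (length-replicate e)) (sym len)) ⟩
  length xs * S (2 + k ∷ 1 ∷ replicate e 0) xs ≡⟨ cong (_* S (2 + k ∷ 1 ∷ replicate e 0) xs) len ⟩
  (2 + e) * S (2 + k ∷ 1 ∷ replicate e 0) xs  ∎)
  where open ≤-Reasoning

sum*powersum : ∀ k xs → sum xs * sum (map (_^ k) xs) ≡ sum (map (_^ suc k) xs) + S (k ∷ 1 ∷ []) xs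
sum*powersum k xs = begin
  sum xs * sum (map (_^ k) xs)              ≡⟨ cong (sum xs *_) (S-singleton k xs) ⟨
  sum xs * S (k ∷ []) xs                    ≡⟨ sum*S (k ∷ []) xs ⟩
  S (suc k ∷ []) xs + S (k ∷ 1 ∷ []) xs     ≡⟨ cong (_+ S (k ∷ 1 ∷ []) xs) (S-singleton (suc k) xs) ⟩
  sum (map (_^ suc k) xs) + S (k ∷ 1 ∷ []) xs ∎
  where open ≡-Reasoning

-- The words of length k + 2 over d letters that are not constant are those
-- whose first k + 1 letters are not all equal, and those that consist of k + 1
-- equal letters and a different one.
nonconstant : ∀ d k → d ^ (2 + k) ∸ d ≡ d * (d ^ suc k ∸ d) + d * (d ∸ 1)
nonconstant zero    k = refl
nonconstant (suc e) k = m+n≡o⇒m≡o∸n′ (begin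
  d * (d ^ suc k ∸ d) + d * e + d ≡⟨ regroup d (d ^ suc k ∸ d) e ⟩
  d * (d ^ suc k ∸ d) + d * d     ≡⟨ *-distribˡ-+ d (d ^ suc k ∸ d) d ⟨
  d * (d ^ suc k ∸ d + d)         ≡⟨ cong (d *_) (m∸n+n≡m (m≤m*n d (d ^ k))) ⟩
  d ^ (2 + k)                     ∎)
  where
  open ≡-Reasoning
  d = suc e
  instance
    _ = m^n≢0 d k
  regroup : ∀ d a e → d * a + d * e + d ≡ d * a + d * (1 + e)
  regroup = solve-∀
  m+n≡o⇒m≡o∸n′ : ∀ {m n o} → m + n ≡ o → o ∸ n ≡ m
  m+n≡o⇒m≡o∸n′ {m} {n} refl = m+n∸n≡m m n

-- `S (flat d k) xs` runs over all `d !` orders of the entries, so it is `d !` times the mean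
-- monomial. The induction multiplies by `sum xs` and follows `nonconstant`: `S-flat-suc` accounts
-- for the words that prolong a nonconstant one, and `S-flat-minimal` for those that prolong a
-- constant one by a different letter, whose monomials sum to `S (suc k ∷ 1 ∷ []) xs`.
power-mean : ∀ e k xs → length xs ≡ 2 + e → let d = 2 + e in
             d ! * sum (map (_^ suc k) xs) + (d ^ suc k ∸ d) * S (flat d (suc k)) xs ≤
             d ! * sum xs ^ suc k
power-mean e zero xs len = ≤-reflexive (begin
  d ! * sum (map (_^ 1) xs) + (d ^ 1 ∸ d) * S (flat d 1) xs
    ≡⟨ cong₂ (λ a b → d ! * a + b * S (flat d 1) xs) (map-^1 xs)
         (trans (cong (_∸ d) (^-identityʳ d)) (n∸n≡0 d)) ⟩
  d ! * sum xs + 0     ≡⟨ +-identityʳ _ ⟩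
  d ! * sum xs         ≡⟨ cong (d ! *_) (^-identityʳ (sum xs)) ⟨
  d ! * sum xs ^ 1     ∎)
  where
  open ≡-Reasoning
  d = 2 + e
power-mean e (suc k) xs len = begin
  d ! * p (2 + k) + (d ^ (2 + k) ∸ d) * φ (2 + k)
    ≡⟨ cong (λ r → d ! * p (2 + k) + r * φ (2 + k)) (nonconstant d k) ⟩
  d ! * p (2 + k) + (d * D + d * suc e) * φ (2 + k)
    ≡⟨ regroup₁ (d ! * p (2 + k)) D (suc e) d (φ (2 + k)) ⟩
  d ! * p (2 + k) + D * (d * φ (2 + k)) + d * suc e * φ (2 + k)
    ≤⟨ +-mono-≤ (+-monoʳ-≤ (d ! * p (2 + k)) (*-monoʳ-≤ D step))
                (*-monoʳ-≤ (d * suc e) (≤-trans (S-flat-minimal e k xs len) (≤-reflexive zeros))) ⟩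
  d ! * p (2 + k) + D * (sum xs * φ (suc k)) + d * suc e * (e ! * S (suc k ∷ 1 ∷ []) xs)
    ≡⟨ regroup₂ d (suc e) (e !) (p (2 + k)) (S (suc k ∷ 1 ∷ []) xs) D (sum xs) (φ (suc k)) ⟩
  d ! * (p (2 + k) + S (suc k ∷ 1 ∷ []) xs) + sum xs * (D * φ (suc k))
    ≡⟨ cong (λ r → d ! * r + sum xs * (D * φ (suc k))) (sum*powersum (suc k) xs) ⟨
  d ! * (sum xs * p (suc k)) + sum xs * (D * φ (suc k))
    ≡⟨ regroup₃ (d !) (sum xs) (p (suc k)) (D * φ (suc k)) ⟩
  sum xs * (d ! * p (suc k) + D * φ (suc k))
    ≤⟨ *-monoʳ-≤ (sum xs) (power-mean e k xs len) ⟩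
  sum xs * (d ! * sum xs ^ suc k)
    ≡⟨ regroup₄ (sum xs) (d !) (sum xs ^ suc k) ⟩
  d ! * sum xs ^ (2 + k) ∎
  where
  open ≤-Reasoning
  d = 2 + e
  D = d ^ suc k ∸ d
  p φ : ℕ → ℕ
  p k = sum (map (_^ k) xs)
  φ k = S (flat d k) xs
  step : d * φ (2 + k) ≤ sum xs * φ (suc k)
  step = subst (λ d → d * S (flat d (2 + k)) xs ≤ sum xs * S (flat d (suc k)) xs) len (S-flat-suc (suc k) xs)
  zeros : S (suc k ∷ 1 ∷ replicate e 0) xs ≡ e ! * S (suc k ∷ 1 ∷ []) xs
  zeros = S-++zeros (suc k ∷ 1 ∷ []) e xs len
  regroup₁ : ∀ a D f d φ → a + (d * D + d * f) * φ ≡ a + D * (d * φ) + d * f * φ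
  regroup₁ = solve-∀
  regroup₂ : ∀ d f e! p s D t φ →
             d * (f * e!) * p + D * (t * φ) + d * f * (e! * s) ≡ d * (f * e!) * (p + s) + t * (D * φ)
  regroup₂ = solve-∀
  regroup₃ : ∀ a t p b → a * (t * p) + t * b ≡ t * (a * p + b)
  regroup₃ = solve-∀
  regroup₄ : ∀ t a b → t * (a * b) ≡ a * (t * b)
  regroup₄ = solve-∀

-- Sums over pairs of disjoint index sets

onPred : (ℕ → ℕ) → ℕ → ℕ
onPred f zero    = 0
onPred f (suc n) = f n

bothZero : ℕ → ℕ → ℕ
bothZero zero    zero    = 1
bothZero zero    (suc q) = 0
bothZero (suc p) q       = 0

bothZero-swap : ∀ p q → bothZero p q ≡ bothZero q p
bothZero-swap zero    zero    = refl
bothZero-swap zero    (suc q) = refl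
bothZero-swap (suc p) zero    = refl
bothZero-swap (suc p) (suc q) = refl

-- The sum of Π_{i ∈ I} uᵢ Π_{j ∈ J} vⱼ over all disjoint index sets I, J of
-- sizes p and q.
G : ℕ → ℕ → List (ℕ × ℕ) → ℕ
G p q []            = bothZero p q
G p q ((u , v) ∷ l) =
  G p q l + u * onPred (λ p′ → G p′ q l) p + v * onPred (λ q′ → G p q′ l) q

onPred-cong : ∀ {f g} → (∀ n → f n ≡ g n) → ∀ n → onPred f n ≡ onPred g n
onPred-cong h zero    = refl
onPred-cong h (suc n) = h n

G-swap : ∀ p q l → G p q l ≡ G q p (map Product.swap l)
G-swap p q []            = bothZero-swap p q
G-swap p q ((u , v) ∷ l)
  rewrite G-swap p q l
        | onPred-cong (λ p′ → G-swap p′ q l) p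
        | onPred-cong (λ q′ → G-swap p q′ l) q =
  exch (G q p (map Product.swap l)) (u * onPred (λ p′ → G q p′ (map Product.swap l)) p)
    (v * onPred (λ q′ → G q′ p (map Product.swap l)) q)
  where
  exch : ∀ a b c → a + b + c ≡ a + c + b
  exch = solve-∀

module _ (u v : ℕ → ℕ) where

  private
    uv : ℕ → ℕ × ℕ
    uv x = u x , v x

  -- Removing `y` and choosing `p` indices for `u` among the rest amounts to choosing `suc p`
  -- indices for `u` and marking one of them.
  Sel-G₁ : ∀ p q xs → Sel (λ y ys → u y * G p q (map uv ys)) xs ≡ suc p * G (suc p) q (map uv xs)
  Sel-G₁ p q []       = sym (*-zeroʳ (suc p))
  Sel-G₁ p q (x ∷ xs) = begin
    u x * g + Sel (λ y ys → u y * (G p q (map uv ys) + u x * gu ys + v x * gv ys)) xs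
      ≡⟨ cong (u x * g +_) (Sel-cong xs λ y ys _ → distr (u y) (u x) (v x) (G p q (map uv ys)) (gu ys) (gv ys)) ⟩
    u x * g + Sel (λ y ys → u y * G p q (map uv ys) + u x * (u y * gu ys) + v x * (u y * gv ys)) xs
      ≡⟨ cong (u x * g +_) (trans (Sel-+ (λ y ys → u y * G p q (map uv ys) + u x * (u y * gu ys)) _ xs)
           (cong₂ _+_ (trans (Sel-+ (λ y ys → u y * G p q (map uv ys)) _ xs)
                         (cong₂ _+_ (Sel-G₁ p q xs) (trans (Sel-*ˡ (u x) _ xs) (cong (u x *_) (lower p)))))
                      (trans (Sel-*ˡ (v x) _ xs) (cong (v x *_) (other q))))) ⟩
    u x * g + (suc p * G (suc p) q (map uv xs) + u x * (p * g) + v x * (suc p * onPred (λ q′ → G (suc p) q′ (map uv xs)) q))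
      ≡⟨ collect p (u x) (v x) g (G (suc p) q (map uv xs)) (onPred (λ q′ → G (suc p) q′ (map uv xs)) q) ⟩
    suc p * G (suc p) q (map uv (x ∷ xs)) ∎
    where
    open ≡-Reasoning
    g = G p q (map uv xs)
    gu gv : List ℕ → ℕ
    gu ys = onPred (λ p′ → G p′ q (map uv ys)) p
    gv ys = onPred (λ q′ → G p q′ (map uv ys)) q
    zeros : Sel (λ y ys → u y * 0) xs ≡ 0
    zeros = trans (Sel-cong xs λ y _ _ → *-zeroʳ (u y)) (trans (Sel-const 0 xs) (*-zeroʳ (length xs)))
    lower : ∀ p → Sel (λ y ys → u y * onPred (λ p′ → G p′ q (map uv ys)) p) xs ≡ p * G p q (map uv xs)
    lower zero    = zeros
    lower (suc p) = Sel-G₁ p q xs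
    other : ∀ q → Sel (λ y ys → u y * onPred (λ q′ → G p q′ (map uv ys)) q) xs ≡
                  suc p * onPred (λ q′ → G (suc p) q′ (map uv xs)) q
    other zero    = trans zeros (sym (*-zeroʳ (suc p)))
    other (suc q) = Sel-G₁ p q xs
    distr : ∀ w a b g h k → w * (g + a * h + b * k) ≡ w * g + a * (w * h) + b * (w * k)
    distr = solve-∀
    collect : ∀ p a b g h k → a * g + ((1 + p) * h + a * (p * g) + b * ((1 + p) * k)) ≡ (1 + p) * (h + a * g + b * k)
    collect = solve-∀

Sel-G₂ : ∀ (u v : ℕ → ℕ) p q xs → let uv = λ x → u x , v x in
         Sel (λ y ys → v y * G p q (map uv ys)) xs ≡ suc q * G p (suc q) (map uv xs)
Sel-G₂ u v p q xs = begin
  Sel (λ y ys → v y * G p q (map uv ys)) xs ≡⟨ Sel-cong xs (λ y ys _ → cong (v y *_) (swapped p q ys)) ⟩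
  Sel (λ y ys → v y * G q p (map vu ys)) xs ≡⟨ Sel-G₁ v u q p xs ⟩
  suc q * G (suc q) p (map vu xs)           ≡⟨ cong (suc q *_) (swapped p (suc q) xs) ⟨
  suc q * G p (suc q) (map uv xs)           ∎
  where
  open ≡-Reasoning
  uv vu : ℕ → ℕ × ℕ
  uv x = u x , v x
  vu x = v x , u x
  swapped : ∀ p q ys → G p q (map uv ys) ≡ G q p (map vu ys)
  swapped p q ys = trans (G-swap p q (map uv ys)) (cong (G q p) (sym (map-∘ ys)))

powers : ℕ → ℕ → ℕ × ℕ
powers s x = x ^ s , x ^ suc s

G-00 : ∀ l → G 0 0 l ≡ 1
G-00 []            = refl
G-00 ((u , v) ∷ l) rewrite G-00 l | *-zeroʳ u | *-zeroʳ v = refl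

-- `S` selects the indices in order, so each pair of index sets is counted once for every order of
-- the first and of the second set.
S-even : ∀ p q s xs → S (even p q s) xs ≡ p ! * q ! * G p q (map (powers s) xs)
S-even zero zero s xs = cong (_+ 0) (sym (G-00 (map (powers s) xs)))
S-even zero (suc q) s xs = begin
  Sel (λ y ys → y ^ suc s * S (even 0 q s) ys) xs
    ≡⟨ Sel-cong xs (λ y ys _ → trans (cong (y ^ suc s *_) (S-even 0 q s ys)) (exch (y ^ suc s) (1 * q !) _)) ⟩
  Sel (λ y ys → 1 * q ! * (y ^ suc s * G 0 q (map (powers s) ys))) xs
    ≡⟨ Sel-*ˡ (1 * q !) _ xs ⟩
  1 * q ! * Sel (λ y ys → y ^ suc s * G 0 q (map (powers s) ys)) xs
    ≡⟨ cong (1 * q ! *_) (Sel-G₂ (_^ s) (_^ suc s) 0 q xs) ⟩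
  1 * q ! * (suc q * G 0 (suc q) (map (powers s) xs))
    ≡⟨ regroup q (q !) _ ⟩
  1 * suc q ! * G 0 (suc q) (map (powers s) xs) ∎
  where
  open ≡-Reasoning
  exch : ∀ a b c → a * (b * c) ≡ b * (a * c)
  exch = solve-∀
  regroup : ∀ q f g → 1 * f * ((1 + q) * g) ≡ 1 * ((1 + q) * f) * g
  regroup = solve-∀
S-even (suc p) q s xs = begin
  Sel (λ y ys → y ^ s * S (even p q s) ys) xs
    ≡⟨ Sel-cong xs (λ y ys _ → trans (cong (y ^ s *_) (S-even p q s ys)) (exch (y ^ s) (p ! * q !) _)) ⟩
  Sel (λ y ys → p ! * q ! * (y ^ s * G p q (map (powers s) ys))) xs
    ≡⟨ Sel-*ˡ (p ! * q !) _ xs ⟩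
  p ! * q ! * Sel (λ y ys → y ^ s * G p q (map (powers s) ys)) xs
    ≡⟨ cong (p ! * q ! *_) (Sel-G₁ (_^ s) (_^ suc s) p q xs) ⟩
  p ! * q ! * (suc p * G (suc p) q (map (powers s) xs))
    ≡⟨ regroup p (p !) (q !) _ ⟩
  suc p ! * q ! * G (suc p) q (map (powers s) xs) ∎
  where
  open ≡-Reasoning
  exch : ∀ a b c → a * (b * c) ≡ b * (a * c)
  exch = solve-∀
  regroup : ∀ p f h g → f * h * ((1 + p) * g) ≡ (1 + p) * f * h * g
  regroup = solve-∀

S-ones : ∀ α xs → All (1 ≡_) xs → length xs ≡ length α → S α xs ≡ length α !
S-ones []      xs ones len = refl
S-ones (a ∷ α) xs ones len = begin
  Sel (λ y ys → y ^ a * S α ys) xs ≡⟨ Sel-cong xs term ⟩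
  Sel (λ _ _ → length α !) xs      ≡⟨ Sel-const (length α !) xs ⟩
  length xs * length α !           ≡⟨ cong (_* length α !) len ⟩
  suc (length α) !                 ∎
  where
  open ≡-Reasoning
  term : ∀ y ys → y ∷ ys ↭ℕ xs → y ^ a * S α ys ≡ length α !
  term y ys p with All-resp-↭ (↭ℕ-sym p) ones
  ... | refl ∷ ones′ = trans
    (cong₂ _*_ (^-zeroˡ a) (S-ones α ys ones′ (suc-injective (trans (↭-length p) len))))
    (*-identityˡ (length α !))

binomial-factorials : ∀ {n k} → k ≤ n → (n C k) * ((n ∸ k) ! * k !) ≡ n !
binomial-factorials {n} {k} k≤n = begin
  (n C k) * ((n ∸ k) ! * k !)          ≡⟨ cong ((n C k) *_) (*-comm ((n ∸ k) !) (k !)) ⟩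
  (n C k) * (k ! * (n ∸ k) !)          ≡⟨ cong (_* (k ! * (n ∸ k) !)) (nCk≡n!/k![n-k]! k≤n) ⟩
  n ! / (k ! * (n ∸ k) !) * (k ! * (n ∸ k) !) ≡⟨ m/n*n≡m (k![n∸k]!∣n! k≤n) ⟩
  n !                                ∎
  where
  open ≡-Reasoning
  instance
    _ = k !* (n ∸ k) !≢0

-- An even tree with k leaves has p branches with s leaves and q branches with
-- s + 1 leaves; a star is split with s = 0 and p = 0 instead of p = d - k, since
-- there is no tree with 0 leaves.
data EvenSplit (d : ℕ) : (k p q s : ℕ) → Set where
  star   : ∀ {k} → k ≤ d → EvenSplit d k 0 k 0
  branch : ∀ {p q s} → p + q ≡ d → EvenSplit d (q + d * s) p q s

split-q≤d : ∀ {d k p q s} → EvenSplit d k p q s → q ≤ d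
split-q≤d (star k≤d)        = k≤d
split-q≤d {p = p} {q} (branch refl) = m≤n+m q p

split-size : ∀ {d k p q s} → EvenSplit d k p q s → p * s + q * suc s ≡ k
split-size {q = q} (star _)      = *-identityʳ q
split-size {p = p} {q} {s} (branch refl) = regroup p q s
  where
  regroup : ∀ p q s → p * s + q * (1 + s) ≡ q + (p + q) * s
  regroup = solve-∀

-- One formula covers both kinds of split: for a branch `d ∸ q` is `p`, and for a star it is the
-- number of zero exponents, whose `(d ∸ q) !` orders all give the same monomial.
S-flat-split : ∀ {d k p q s} → EvenSplit d k p q s → ∀ xs → length xs ≡ d →
               S (flat d k) xs ≡ (d ∸ q) ! * q ! * G p q (map (powers s) xs)
S-flat-split {d} {k} {p} {q} {s} (branch refl) xs len = begin
  S (flat d k) xs                              ≡⟨ cong (λ α → S α xs) (flat-even d p q s refl) ⟩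
  S (even p q s) xs                            ≡⟨ S-even p q s xs ⟩
  p ! * q ! * G p q (map (powers s) xs)        ≡⟨ cong (λ r → r ! * q ! * G p q (map (powers s) xs)) (m+n∸n≡m p q) ⟨
  (p + q ∸ q) ! * q ! * G p q (map (powers s) xs) ∎
  where open ≡-Reasoning
S-flat-split {d} {k} (star k≤d) xs len = begin
  S (flat d k) xs                              ≡⟨ cong (λ r → S (flat d r) xs) (trans (cong (k +_) (*-zeroʳ d)) (+-identityʳ k)) ⟨
  S (flat d (k + d * 0)) xs                    ≡⟨ cong (λ α → S α xs) (flat-even d (d ∸ k) k 0 (m∸n+n≡m k≤d)) ⟩
  S (replicate (d ∸ k) 0 ++ replicate k 1) xs  ≡⟨ S-↭ (++-comm (replicate (d ∸ k) 0) (replicate k 1)) xs ⟩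
  S (even 0 k 0 ++ replicate (d ∸ k) 0) xs
    ≡⟨ S-++zeros (even 0 k 0) (d ∸ k) xs
         (trans len (trans (sym (m+[n∸m]≡n k≤d)) (cong (_+ (d ∸ k)) (sym (length-even 0 k 0))))) ⟩
  (d ∸ k) ! * S (even 0 k 0) xs                ≡⟨ cong ((d ∸ k) ! *_) (S-even 0 k 0 xs) ⟩
  (d ∸ k) ! * (1 * k ! * G 0 k (map (powers 0) xs)) ≡⟨ regroup ((d ∸ k) !) (k !) _ ⟩
  (d ∸ k) ! * k ! * G 0 k (map (powers 0) xs)  ∎
  where
  open ≡-Reasoning
  regroup : ∀ a b c → a * (1 * b * c) ≡ a * b * c
  regroup = solve-∀

length-flat : ∀ d k → length (flat d k) ≡ d
length-flat d zero    = length-replicate d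
length-flat d (suc k) with flat d k | length-flat d k
... | []    | len = len
... | a ∷ α | len = trans (sym (↭-length (∷↭∷ʳ (suc a) α))) len

-- This is `S-flat-split` at the all-ones list, where `S` just counts the `d !` orders of the
-- entries.
G-ones : ∀ {d k p q s} → EvenSplit d k p q s → G p q (replicate d (1 , 1)) ≡ d C q
G-ones {d} {k} {p} {q} {s} split = *-cancelˡ-≡ _ _ ((d ∸ q) ! * q !) (begin
  (d ∸ q) ! * q ! * G p q (replicate d (1 , 1))
    ≡⟨ cong (λ l → (d ∸ q) ! * q ! * G p q l)
         (trans (map-replicate (powers s) d 1) (cong (replicate d) (cong₂ _,_ (^-zeroˡ s) (^-zeroˡ (suc s))))) ⟨
  (d ∸ q) ! * q ! * G p q (map (powers s) (replicate d 1))
    ≡⟨ S-flat-split split (replicate d 1) (length-replicate d) ⟨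
  S (flat d k) (replicate d 1)
    ≡⟨ S-ones (flat d k) (replicate d 1) (replicate⁺ d refl) (trans (length-replicate d) (sym (length-flat d k))) ⟩
  length (flat d k) !
    ≡⟨ cong _! (length-flat d k) ⟩
  d !
    ≡⟨ binomial-factorials (split-q≤d split) ⟨
  (d C q) * ((d ∸ q) ! * q !)
    ≡⟨ *-comm (d C q) _ ⟩
  (d ∸ q) ! * q ! * (d C q) ∎)
  where
  open ≡-Reasoning
  instance
    _ = (d ∸ q) !* q !≢0

-- `G p q` is homogeneous of degree `p` in the first components and `q` in the second, so this is
-- monotonicity under the bounds u ≤ (a′ / a) u′ and v ≤ (b′ / b) v′, with denominators cleared.
G-mono : ∀ {a a′ b b′ l l′} →
         Pointwise (λ (u , v) (u′ , v′) → a * u ≤ a′ * u′ × b * v ≤ b′ * v′) l l′ →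
         ∀ p q → a ^ p * b ^ q * G p q l ≤ a′ ^ p * b′ ^ q * G p q l′
G-mono []                              zero    zero    = ≤-refl
G-mono {a} {b = b} []                  zero    (suc q) = ≤-trans (≤-reflexive (*-zeroʳ (1 * b ^ suc q))) z≤n
G-mono {a} {b = b} []                  (suc p) q       = ≤-trans (≤-reflexive (*-zeroʳ (a ^ suc p * b ^ q))) z≤n
G-mono {a} {a′} {b} {b′} {(u , v) ∷ l} {(u′ , v′) ∷ l′} ((hu , hv) ∷ h) p q = begin
  a ^ p * b ^ q * (G p q l + u * gu + v * gv)
    ≡⟨ distr (a ^ p * b ^ q) (G p q l) (u * gu) (v * gv) ⟩
  a ^ p * b ^ q * G p q l + a ^ p * b ^ q * (u * gu) + a ^ p * b ^ q * (v * gv)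
    ≤⟨ +-mono-≤ (+-mono-≤ (G-mono h p q) (left p)) (right q) ⟩
  a′ ^ p * b′ ^ q * G p q l′ + a′ ^ p * b′ ^ q * (u′ * gu′) + a′ ^ p * b′ ^ q * (v′ * gv′)
    ≡⟨ distr (a′ ^ p * b′ ^ q) (G p q l′) (u′ * gu′) (v′ * gv′) ⟨
  a′ ^ p * b′ ^ q * (G p q l′ + u′ * gu′ + v′ * gv′) ∎
  where
  open ≤-Reasoning
  gu = onPred (λ p → G p q l) p
  gv = onPred (λ q → G p q l) q
  gu′ = onPred (λ p → G p q l′) p
  gv′ = onPred (λ q → G p q l′) q
  distr : ∀ c x y z → c * (x + y + z) ≡ c * x + c * y + c * z
  distr = solve-∀
  vanish : ∀ c u m → c * (u * 0) ≤ m
  vanish c u m rewrite *-zeroʳ u | *-zeroʳ c = z≤n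
  factor₁ : ∀ a ap bq u g → a * ap * bq * (u * g) ≡ a * u * (ap * bq * g)
  factor₁ = solve-∀
  factor₂ : ∀ b ap bq v g → ap * (b * bq) * (v * g) ≡ b * v * (ap * bq * g)
  factor₂ = solve-∀
  left : ∀ p → a ^ p * b ^ q * (u * onPred (λ p → G p q l) p) ≤ a′ ^ p * b′ ^ q * (u′ * onPred (λ p → G p q l′) p)
  left zero    = vanish (1 * b ^ q) u _
  left (suc p) = begin
    a * a ^ p * b ^ q * (u * G p q l)         ≡⟨ factor₁ a (a ^ p) (b ^ q) u (G p q l) ⟩
    a * u * (a ^ p * b ^ q * G p q l)         ≤⟨ *-mono-≤ hu (G-mono h p q) ⟩
    a′ * u′ * (a′ ^ p * b′ ^ q * G p q l′)    ≡⟨ factor₁ a′ (a′ ^ p) (b′ ^ q) u′ (G p q l′) ⟨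
    a′ * a′ ^ p * b′ ^ q * (u′ * G p q l′)    ∎
  right : ∀ q → a ^ p * b ^ q * (v * onPred (λ q → G p q l) q) ≤ a′ ^ p * b′ ^ q * (v′ * onPred (λ q → G p q l′) q)
  right zero    = vanish (a ^ p * 1) v _
  right (suc q) = begin
    a ^ p * (b * b ^ q) * (v * G p q l)         ≡⟨ factor₂ b (a ^ p) (b ^ q) v (G p q l) ⟩
    b * v * (a ^ p * b ^ q * G p q l)         ≤⟨ *-mono-≤ hv (G-mono h p q) ⟩
    b′ * v′ * (a′ ^ p * b′ ^ q * G p q l′)    ≡⟨ factor₂ b′ (a′ ^ p) (b′ ^ q) v′ (G p q l′) ⟨
    a′ ^ p * (b′ * b′ ^ q) * (v′ * G p q l′)    ∎

-- Homogeneity is read off from `G-mono`, with the weights `u` and `v` attached to the all-ones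
-- list.
G-replicate : ∀ {d k p q s} → EvenSplit d k p q s → ∀ u v →
              (d C q) * (u ^ p * v ^ q) ≤ G p q (replicate d (u , v))
G-replicate {d} {p = p} {q} split u v = begin
  (d C q) * (u ^ p * v ^ q)                            ≡⟨ cong (_* (u ^ p * v ^ q)) (G-ones split) ⟨
  G p q (replicate d (1 , 1)) * (u ^ p * v ^ q)        ≡⟨ *-comm _ (u ^ p * v ^ q) ⟩
  u ^ p * v ^ q * G p q (replicate d (1 , 1))          ≤⟨ G-mono (pointwise d) p q ⟩
  1 ^ p * 1 ^ q * G p q (replicate d (u , v))
    ≡⟨ cong (_* G p q (replicate d (u , v))) (cong₂ _*_ (^-zeroˡ p) (^-zeroˡ q)) ⟩
  1 * G p q (replicate d (u , v))                      ≡⟨ *-identityˡ _ ⟩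
  G p q (replicate d (u , v))                          ∎
  where
  open ≤-Reasoning
  pointwise : ∀ d → Pointwise (λ (a , b) (a′ , b′) → u * a ≤ 1 * a′ × v * b ≤ 1 * b′)
                              (replicate d (1 , 1)) (replicate d (u , v))
  pointwise zero    = []
  pointwise (suc d) = (≤-reflexive (*-comm u 1) , ≤-reflexive (*-comm v 1)) ∷ pointwise d

G-++ : ∀ p q l l′ → G p q l ≤ G p q (l′ ++ l)
G-++ p q l []       = ≤-refl
G-++ p q l (_ ∷ l′) = ≤-trans (G-++ p q l l′) (≤-trans (m≤m+n _ _) (m≤m+n _ _))

-- A vertex may have fewer than `d` children; the missing branches are given size 0, which keeps the
-- sum of the sizes and cannot decrease the left side. Multiplying by `f` turns `d C q` into the
-- `d !` of `power-mean`.
power-mean-split : ∀ {e k p q s} → let d = 2 + e in EvenSplit d (suc k) p q s → ∀ xs → length xs ≤ d →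
                   (d C q) * sum (map (_^ suc k) xs) + (d ^ suc k ∸ d) * G p q (map (powers s) xs) ≤
                   (d C q) * sum xs ^ suc k
power-mean-split {e} {k} {p} {q} {s} split xs len = *-cancelˡ-≤ f (begin
  f * ((d C q) * P xs + D * Γ xs)
    ≤⟨ *-monoʳ-≤ f (+-mono-≤ (*-monoʳ-≤ (d C q) P-pad) (*-monoʳ-≤ D Γ-pad)) ⟩
  f * ((d C q) * P ys + D * Γ ys)
    ≡⟨ regroup₁ f (d C q) (P ys) D (Γ ys) ⟩
  (d C q) * f * P ys + D * (f * Γ ys)
    ≡⟨ cong₂ (λ x y → x * P ys + D * y) (binomial-factorials (split-q≤d split)) (sym (S-flat-split split ys ys-length)) ⟩
  d ! * P ys + D * S (flat d (suc k)) ys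
    ≤⟨ power-mean e k ys ys-length ⟩
  d ! * sum ys ^ suc k
    ≡⟨ cong (λ r → d ! * r ^ suc k) sum-pad ⟩
  d ! * sum xs ^ suc k
    ≡⟨ cong (_* sum xs ^ suc k) (binomial-factorials (split-q≤d split)) ⟨
  (d C q) * f * sum xs ^ suc k
    ≡⟨ regroup₂ (d C q) f (sum xs ^ suc k) ⟩
  f * ((d C q) * sum xs ^ suc k) ∎)
  where
  open ≤-Reasoning
  d = 2 + e
  D = d ^ suc k ∸ d
  f = (d ∸ q) ! * q !
  instance
    _ = (d ∸ q) !* q !≢0
  P Γ : List ℕ → ℕ
  P xs = sum (map (_^ suc k) xs)
  Γ xs = G p q (map (powers s) xs)
  ys = replicate (d ∸ length xs) 0 ++ xs
  ys-length : length ys ≡ d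
  ys-length = trans (length-++ (replicate (d ∸ length xs) 0))
                      (trans (cong (_+ length xs) (length-replicate (d ∸ length xs))) (m∸n+n≡m len))
  sum-zeros : ∀ m → sum (replicate m 0) ≡ 0
  sum-zeros zero    = refl
  sum-zeros (suc m) = sum-zeros m
  sum-pad : sum ys ≡ sum xs
  sum-pad = trans (sum-++ (replicate (d ∸ length xs) 0) xs) (cong (_+ sum xs) (sum-zeros (d ∸ length xs)))
  P-pad : P xs ≤ P ys
  P-pad = begin
    P xs                                          ≤⟨ m≤n+m (P xs) (P (replicate (d ∸ length xs) 0)) ⟩
    P (replicate (d ∸ length xs) 0) + P xs        ≡⟨ sum-++ (map (_^ suc k) (replicate (d ∸ length xs) 0)) _ ⟨
    sum (map (_^ suc k) (replicate (d ∸ length xs) 0) ++ map (_^ suc k) xs)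
      ≡⟨ cong sum (map-++ (_^ suc k) (replicate (d ∸ length xs) 0) xs) ⟨
    P ys                                          ∎
  Γ-pad : Γ xs ≤ Γ ys
  Γ-pad = ≤-trans (G-++ p q (map (powers s) xs) (map (powers s) (replicate (d ∸ length xs) 0)))
                  (≤-reflexive (cong (G p q) (sym (map-++ (powers s) (replicate (d ∸ length xs) 0) xs))))
  regroup₁ : ∀ f c p D g → f * (c * p + D * g) ≡ c * f * p + D * (f * g)
  regroup₁ = solve-∀
  regroup₂ : ∀ c f t → c * f * t ≡ f * (c * t)
  regroup₂ = solve-∀

-- Counting leaf sets

∑ : {A : Set} → (A → ℕ) → List A → ℕ
∑ f xs = sum (map f xs)

∑-++ : ∀ {A : Set} (f : A → ℕ) xs ys → ∑ f (xs ++ ys) ≡ ∑ f xs + ∑ f ys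
∑-++ f xs ys = trans (cong sum (map-++ f xs ys)) (sum-++ (map f xs) (map f ys))

∑-map : ∀ {A B : Set} (f : B → ℕ) (g : A → B) xs → ∑ f (map g xs) ≡ ∑ (f ∘ g) xs
∑-map f g xs = cong sum (sym (map-∘ xs))

∑-cong : ∀ {A : Set} {f g : A → ℕ} → (∀ x → f x ≡ g x) → ∀ xs → ∑ f xs ≡ ∑ g xs
∑-cong h xs = cong sum (map-cong h xs)

∑-+ : ∀ {A : Set} (f g : A → ℕ) xs → ∑ (λ x → f x + g x) xs ≡ ∑ f xs + ∑ g xs
∑-+ f g []       = refl
∑-+ f g (x ∷ xs) rewrite ∑-+ f g xs = interchange (f x) (g x) (∑ f xs) (∑ g xs)

∑-*ʳ : ∀ {A : Set} (f : A → ℕ) c xs → ∑ (λ x → f x * c) xs ≡ ∑ f xs * c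
∑-*ʳ f c []       = refl
∑-*ʳ f c (x ∷ xs) rewrite ∑-*ʳ f c xs = sym (*-distribʳ-+ c (f x) (∑ f xs))

∑-zero : ∀ {A : Set} (xs : List A) → ∑ (const 0) xs ≡ 0
∑-zero []       = refl
∑-zero (x ∷ xs) = ∑-zero xs

ι : {P : Set} → Dec P → ℕ
ι P? = if does P? then 1 else 0

ι-yes : {P : Set} → (P? : Dec P) → P → ι P? ≡ 1
ι-yes (yes _) p = refl
ι-yes (no ¬p) p = contradiction p ¬p

ι-no : {P : Set} → (P? : Dec P) → ¬ P → ι P? ≡ 0
ι-no (yes p) ¬p = contradiction p ¬p
ι-no (no _)  ¬p = refl

ι-cong : {P Q : Set} → (P? : Dec P) (Q? : Dec Q) → (P → Q) → (Q → P) → ι P? ≡ ι Q?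
ι-cong (yes p) Q? f g = sym (ι-yes Q? (f p))
ι-cong (no ¬p) Q? f g = sym (ι-no Q? (¬p ∘ g))

length-filter-filter : ∀ {A : Set} {P Q : A → Set} (P? : ∀ x → Dec (P x)) (Q? : ∀ x → Dec (Q x)) →
                       (∀ {x} → P x → Q x) → ∀ xs → length (filter P? (filter Q? xs)) ≡ ∑ (ι ∘ P?) xs
length-filter-filter P? Q? P⇒Q [] = refl
length-filter-filter P? Q? P⇒Q (x ∷ xs) with Q? x
... | no ¬q = trans (length-filter-filter P? Q? P⇒Q xs) (cong (_+ ∑ (ι ∘ P?) xs) (sym (ι-no (P? x) (¬q ∘ P⇒Q))))
... | yes _ with P? x
...   | yes _ = cong suc (length-filter-filter P? Q? P⇒Q xs)
...   | no  _ = length-filter-filter P? Q? P⇒Q xs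

∑-subsets-+ : ∀ m n (g : Subset m → Subset n → ℕ) →
              ∑ (λ S → g (take m S) (drop m S)) (subsets (m + n)) ≡ ∑ (λ R → ∑ (g R) (subsets n)) (subsets m)
∑-subsets-+ zero    n g = sym (+-identityʳ _)
∑-subsets-+ (suc m) n g = begin
  ∑ f (map (inside ∷_) (subsets (m + n)) ++ map (outside ∷_) (subsets (m + n)))
    ≡⟨ ∑-++ f (map (inside ∷_) (subsets (m + n))) _ ⟩
  ∑ f (map (inside ∷_) (subsets (m + n))) + ∑ f (map (outside ∷_) (subsets (m + n)))
    ≡⟨ cong₂ _+_ (half inside) (half outside) ⟩
  ∑ h (map (inside ∷_) (subsets m)) + ∑ h (map (outside ∷_) (subsets m))
    ≡⟨ ∑-++ h (map (inside ∷_) (subsets m)) _ ⟨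
  ∑ h (map (inside ∷_) (subsets m) ++ map (outside ∷_) (subsets m)) ∎
  where
  open ≡-Reasoning
  f : Subset (suc m + n) → ℕ
  f S = g (take (suc m) S) (drop (suc m) S)
  h : Subset (suc m) → ℕ
  h R = ∑ (g R) (subsets n)
  half : ∀ x → ∑ f (map (x ∷_) (subsets (m + n))) ≡ ∑ h (map (x ∷_) (subsets m))
  half x = trans (∑-map f (x ∷_) (subsets (m + n)))
                 (trans (∑-subsets-+ m n (λ R → g (x ∷ R))) (sym (∑-map h (x ∷_) (subsets m))))

∣∣-take-drop : ∀ m {n} (S : Subset (m + n)) → ∣ S ∣ ≡ ∣ take m S ∣ + ∣ drop m S ∣
∣∣-take-drop zero    S             = refl
∣∣-take-drop (suc m) (inside  ∷ S) = cong suc (∣∣-take-drop m S)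
∣∣-take-drop (suc m) (outside ∷ S) = ∣∣-take-drop m S

infixr 5 _?∷_

_?∷_ : Maybe Tree → List Tree → List Tree
nothing ?∷ L = L
just u  ?∷ L = u ∷ L

-- What the nonempty induced branches become at their parent: a lone branch replaces the parent,
-- since a vertex with one child is suppressed.
root : List Tree → Maybe Tree
root []          = nothing
root (u ∷ [])    = just u
root (u ∷ v ∷ L) = just (node (u ∷ v ∷ L))

inducedₗ : (ts : List Tree) → Subset ‖ ts ‖ₗ → List Tree
inducedₗ ts S = map suppress (pruneₗ ts S)

suppressₗ≡map : ∀ ts → suppressₗ ts ≡ map suppress ts
suppressₗ≡map []       = refl
suppressₗ≡map (t ∷ ts) = cong (suppress t ∷_) (suppressₗ≡map ts)

induced-node : ∀ t ts S → induced (node (t ∷ ts)) S ≡ root (inducedₗ (t ∷ ts) S)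
induced-node t ts S with pruneₗ (t ∷ ts) S
... | []         = refl
... | u ∷ []     = refl
... | u ∷ v ∷ us = cong (λ L → just (node (suppress u ∷ suppress v ∷ L))) (suppressₗ≡map us)

inducedₗ-∷ : ∀ t ts S → inducedₗ (t ∷ ts) S ≡ induced t (take ‖ t ‖ S) ?∷ inducedₗ ts (drop ‖ t ‖ S)
inducedₗ-∷ t ts S with prune t (take ‖ t ‖ S)
... | nothing = refl
... | just u  = refl

sizeₘ : Maybe Tree → ℕ
sizeₘ nothing  = 0
sizeₘ (just U) = ‖ U ‖

size-?∷ : ∀ m L → ‖ m ?∷ L ‖ₗ ≡ sizeₘ m + ‖ L ‖ₗ
size-?∷ nothing  L = refl
size-?∷ (just u) L = refl

size-root : ∀ L → sizeₘ (root L) ≡ ‖ L ‖ₗ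
size-root []          = refl
size-root (u ∷ [])    = sym (+-identityʳ ‖ u ‖)
size-root (u ∷ v ∷ L) = refl

mutual
  size-induced : ∀ T S → sizeₘ (induced T S) ≡ ∣ S ∣
  size-induced leaf (inside  ∷ []) = refl
  size-induced leaf (outside ∷ []) = refl
  size-induced (node (t ∷ ts)) S =
    trans (cong sizeₘ (induced-node t ts S)) (trans (size-root (inducedₗ (t ∷ ts) S)) (size-inducedₗ (t ∷ ts) S))

  size-inducedₗ : ∀ ts S → ‖ inducedₗ ts S ‖ₗ ≡ ∣ S ∣
  size-inducedₗ []       []  = refl
  size-inducedₗ (t ∷ ts) S = begin
    ‖ inducedₗ (t ∷ ts) S ‖ₗ
      ≡⟨ cong ‖_‖ₗ (inducedₗ-∷ t ts S) ⟩
    ‖ induced t (take ‖ t ‖ S) ?∷ inducedₗ ts (drop ‖ t ‖ S) ‖ₗ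
      ≡⟨ size-?∷ (induced t (take ‖ t ‖ S)) _ ⟩
    sizeₘ (induced t (take ‖ t ‖ S)) + ‖ inducedₗ ts (drop ‖ t ‖ S) ‖ₗ
      ≡⟨ cong₂ _+_ (size-induced t (take ‖ t ‖ S)) (size-inducedₗ ts (drop ‖ t ‖ S)) ⟩
    ∣ take ‖ t ‖ S ∣ + ∣ drop ‖ t ‖ S ∣
      ≡⟨ ∣∣-take-drop ‖ t ‖ S ⟨
    ∣ S ∣ ∎
    where open ≡-Reasoning

mutual
  ‖‖-cong : ∀ {T U} → T ≅ U → ‖ T ‖ ≡ ‖ U ‖
  ‖‖-cong {leaf}            {leaf}            (permute p) = refl
  ‖‖-cong {leaf}            {node (_ ∷ _)}    (permute p) with () ← xs↭ys⇒|xs|≡|ys| p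
  ‖‖-cong {node (_ ∷ _)}    {leaf}            (permute p) with () ← xs↭ys⇒|xs|≡|ys| p
  ‖‖-cong {node (_ ∷ _)}    {node (_ ∷ _)}    (permute p) = ‖‖ₗ-cong p

  ‖‖ₗ-cong : ∀ {ts us} → Permutation _≅_ ts us → ‖ ts ‖ₗ ≡ ‖ us ‖ₗ
  ‖‖ₗ-cong (Homogeneous.refl es)   = ‖‖ₗ-pointwise es
  ‖‖ₗ-cong (prep e p)              = cong₂ _+_ (‖‖-cong e) (‖‖ₗ-cong p)
  ‖‖ₗ-cong (swap {xs} {ys} {x} {y} {x′} {y′} e f p) = begin
    ‖ x ‖ + (‖ y ‖ + ‖ xs ‖ₗ)     ≡⟨ cong₂ _+_ (‖‖-cong e) (cong₂ _+_ (‖‖-cong f) (‖‖ₗ-cong p)) ⟩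
    ‖ x′ ‖ + (‖ y′ ‖ + ‖ ys ‖ₗ)   ≡⟨ exch (‖ x′ ‖) (‖ y′ ‖) (‖ ys ‖ₗ) ⟩
    ‖ y′ ‖ + (‖ x′ ‖ + ‖ ys ‖ₗ)   ∎
    where
    open ≡-Reasoning
    exch : ∀ a b c → a + (b + c) ≡ b + (a + c)
    exch = solve-∀
  ‖‖ₗ-cong (Homogeneous.trans p q) = trans (‖‖ₗ-cong p) (‖‖ₗ-cong q)

  ‖‖ₗ-pointwise : ∀ {ts us} → Pointwise _≅_ ts us → ‖ ts ‖ₗ ≡ ‖ us ‖ₗ
  ‖‖ₗ-pointwise []       = refl
  ‖‖ₗ-pointwise (e ∷ es) = cong₂ _+_ (‖‖-cong e) (‖‖ₗ-pointwise es)

-- The sum runs over leaf sets of all sizes, with a weight depending on the induced tree; in this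
-- form it factors over the children of a vertex.
W : Tree → (Maybe Tree → ℕ) → ℕ
W T f = ∑ (f ∘ induced T) (subsets ‖ T ‖)

Wₗ : List Tree → (List Tree → ℕ) → ℕ
Wₗ ts f = ∑ (f ∘ inducedₗ ts) (subsets ‖ ts ‖ₗ)

W-cong : ∀ T {f g} → (∀ m → f m ≡ g m) → W T f ≡ W T g
W-cong T h = ∑-cong (h ∘ induced T) (subsets ‖ T ‖)

Wₗ-cong : ∀ ts {f g} → (∀ L → f L ≡ g L) → Wₗ ts f ≡ Wₗ ts g
Wₗ-cong ts h = ∑-cong (h ∘ inducedₗ ts) (subsets ‖ ts ‖ₗ)

W-node : ∀ t ts f → W (node (t ∷ ts)) f ≡ Wₗ (t ∷ ts) (f ∘ root)
W-node t ts f = ∑-cong (cong f ∘ induced-node t ts) (subsets ‖ t ∷ ts ‖ₗ)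

Wₗ-∷ : ∀ t ts f → Wₗ (t ∷ ts) f ≡ W t (λ m → Wₗ ts (λ L → f (m ?∷ L)))
Wₗ-∷ t ts f = trans
  (∑-cong (cong f ∘ inducedₗ-∷ t ts) (subsets ‖ t ∷ ts ‖ₗ))
  (∑-subsets-+ (‖ t ‖) (‖ ts ‖ₗ) λ R S → f (induced t R ?∷ inducedₗ ts S))

occurs : Tree → Maybe Tree → ℕ
occurs D nothing  = 0
occurs D (just U) = ι (U ≅? D)

isNothing : Maybe Tree → ℕ
isNothing nothing  = 1
isNothing (just _) = 0

isEmpty : List Tree → ℕ
isEmpty []      = 1
isEmpty (_ ∷ _) = 0

isSingleton : Tree → List Tree → ℕ
isSingleton D (u ∷ []) = ι (u ≅? D)
isSingleton D _        = 0

-- An induced tree has as many leaves as its leaf set has elements, and isomorphic trees have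
-- equally many leaves, so every leaf set that induces `D` passes the size filter of `copies`.
copies≡W : ∀ D T → copies D T ≡ W T (occurs D)
copies≡W D T = trans
  (length-filter-filter (induces? D T) (λ S → ∣ S ∣ ≟ ‖ D ‖)
     (λ { {S} (U , eq , e) → trans (sym (trans (sym (cong sizeₘ eq)) (size-induced T S))) (‖‖-cong e) })
     (subsets ‖ T ‖))
  (∑-cong term (subsets ‖ T ‖))
  where
  term : ∀ S → ι (induces? D T S) ≡ occurs D (induced T S)
  term S with induced T S
  ... | nothing = refl
  ... | just U  = refl

mutual
  W-isNothing : ∀ T → W T isNothing ≡ 1
  W-isNothing leaf            = refl
  W-isNothing (node (t ∷ ts)) = trans (W-node t ts isNothing)
    (trans (Wₗ-cong (t ∷ ts) isNothing-root) (Wₗ-isEmpty (t ∷ ts)))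
    where
    isNothing-root : ∀ L → isNothing (root L) ≡ isEmpty L
    isNothing-root []          = refl
    isNothing-root (_ ∷ [])    = refl
    isNothing-root (_ ∷ _ ∷ _) = refl

  Wₗ-isEmpty : ∀ ts → Wₗ ts isEmpty ≡ 1
  Wₗ-isEmpty []       = refl
  Wₗ-isEmpty (t ∷ ts) = trans (Wₗ-∷ t ts isEmpty)
    (trans (W-cong t others-empty) (W-isNothing t))
    where
    others-empty : ∀ m → Wₗ ts (λ L → isEmpty (m ?∷ L)) ≡ isNothing m
    others-empty nothing  = Wₗ-isEmpty ts
    others-empty (just _) = ∑-zero (subsets ‖ ts ‖ₗ)

-- A leaf set with a single induced branch meets only one tree of the list. Each of the others
-- contributes its empty leaf set, hence a factor 1.
Wₗ-isSingleton : ∀ D ts → Wₗ ts (isSingleton D) ≡ ∑ (λ t → W t (occurs D)) ts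
Wₗ-isSingleton D []       = refl
Wₗ-isSingleton D (t ∷ ts) = begin
  Wₗ (t ∷ ts) (isSingleton D)
    ≡⟨ Wₗ-∷ t ts (isSingleton D) ⟩
  W t (λ m → Wₗ ts (λ L → isSingleton D (m ?∷ L)))
    ≡⟨ W-cong t inner ⟩
  W t (λ m → occurs D m + isNothing m * X)
    ≡⟨ ∑-+ (occurs D ∘ induced t) _ (subsets ‖ t ‖) ⟩
  W t (occurs D) + W t (λ m → isNothing m * X)
    ≡⟨ cong (W t (occurs D) +_) (∑-*ʳ (isNothing ∘ induced t) X (subsets ‖ t ‖)) ⟩
  W t (occurs D) + W t isNothing * X
    ≡⟨ cong (λ r → W t (occurs D) + r * X) (W-isNothing t) ⟩
  W t (occurs D) + 1 * X
    ≡⟨ cong (W t (occurs D) +_) (trans (*-identityˡ X) (Wₗ-isSingleton D ts)) ⟩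
  ∑ (λ t → W t (occurs D)) (t ∷ ts) ∎
  where
  open ≡-Reasoning
  X = Wₗ ts (isSingleton D)
  singleton-∷ : ∀ u L → isSingleton D (u ∷ L) ≡ isEmpty L * ι (u ≅? D)
  singleton-∷ u []      = sym (*-identityˡ _)
  singleton-∷ u (_ ∷ _) = refl
  inner : ∀ m → Wₗ ts (λ L → isSingleton D (m ?∷ L)) ≡ occurs D m + isNothing m * X
  inner nothing  = sym (*-identityˡ X)
  inner (just u) = begin
    Wₗ ts (λ L → isSingleton D (u ∷ L))
      ≡⟨ Wₗ-cong ts (singleton-∷ u) ⟩
    Wₗ ts (λ L → isEmpty L * ι (u ≅? D))
      ≡⟨ ∑-*ʳ (isEmpty ∘ inducedₗ ts) (ι (u ≅? D)) (subsets ‖ ts ‖ₗ) ⟩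
    Wₗ ts isEmpty * ι (u ≅? D)
      ≡⟨ cong (_* ι (u ≅? D)) (Wₗ-isEmpty ts) ⟩
    1 * ι (u ≅? D)
      ≡⟨ trans (*-identityˡ _) (sym (+-identityʳ _)) ⟩
    ι (u ≅? D) + 0 ∎

module _ (T U : Tree) (T≇U : ¬ T ≅ U) where

  private
    mix : ℕ → ℕ → List Tree
    mix p q = replicate p T ++ replicate q U

  ∈-mix : ∀ {u L} p q → (u ∷ L) ↭ mix p q → (u ≅ T × p ≢ 0) ⊎ (u ≅ U × q ≢ 0)
  ∈-mix {u} p q π = find p q (∈-resp-↭ π (here ≅-refl))
    where
    find : ∀ p q → u ∈≅ mix p q → (u ≅ T × p ≢ 0) ⊎ (u ≅ U × q ≢ 0)
    find zero    (suc q) (here e)   = inj₂ (e , λ ())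
    find zero    (suc q) (there u∈) with find zero q u∈
    ... | inj₁ (_ , 0≢0) = contradiction refl 0≢0
    ... | inj₂ (e , _)   = inj₂ (e , λ ())
    find (suc p) q       (here e)   = inj₁ (e , λ ())
    find (suc p) q       (there u∈) with find p q u∈
    ... | inj₁ (e , _)   = inj₁ (e , λ ())
    ... | inj₂ r         = inj₂ r

  match-T : ∀ {u} L p q → u ≅ T → ι ((u ∷ L) ↭? mix p q) ≡ onPred (λ p → ι (L ↭? mix p q)) p
  match-T {u} L zero    q u≅T = ι-no ((u ∷ L) ↭? mix 0 q) λ π → case ∈-mix 0 q π of λ
    { (inj₁ (_ , 0≢0)) → 0≢0 refl ; (inj₂ (u≅U , _)) → T≇U (≅-trans (≅-sym u≅T) u≅U) }
  match-T {u} L (suc p) q u≅T = ι-cong ((u ∷ L) ↭? mix (suc p) q) (L ↭? mix p q)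
    (λ π → drop-∷ (↭-trans (prep (≅-sym u≅T) ↭-refl) π)) (prep u≅T)

  match-U : ∀ {u} L p q → u ≅ U → ι ((u ∷ L) ↭? mix p q) ≡ onPred (λ q → ι (L ↭? mix p q)) q
  match-U {u} L p zero    u≅U = ι-no ((u ∷ L) ↭? mix p 0) λ π → case ∈-mix p 0 π of λ
    { (inj₂ (_ , 0≢0)) → 0≢0 refl ; (inj₁ (u≅T , _)) → T≇U (≅-trans (≅-sym u≅T) u≅U) }
  match-U {u} L p (suc q) u≅U = ι-cong ((u ∷ L) ↭? mix p (suc q)) (L ↭? mix p q)
    (λ π → drop-∷ (↭-trans (prep (≅-sym u≅U) ↭-refl) (↭-trans π U-first)))
    (λ π → ↭-trans (prep u≅U π) (↭-sym U-first))
    where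
    U-first : mix p (suc q) ↭ U ∷ mix p q
    U-first = shift ≅-refl (replicate p T) (replicate q U)

  -- As `T` and `U` are not isomorphic, `u` can be matched with only one kind of branch, and
  -- cancelling the matched pair lowers `p` or `q`.
  match-∷ : ∀ u L p q → ι ((u ∷ L) ↭? mix p q) ≡
            ι (u ≅? T) * onPred (λ p → ι (L ↭? mix p q)) p + ι (u ≅? U) * onPred (λ q → ι (L ↭? mix p q)) q
  match-∷ u L p q = by-cases (u ≅? T) (u ≅? U)
    where
    X = onPred (λ p → ι (L ↭? mix p q)) p
    Y = onPred (λ q → ι (L ↭? mix p q)) q
    by-cases : (d : Dec (u ≅ T)) (e : Dec (u ≅ U)) → ι ((u ∷ L) ↭? mix p q) ≡ ι d * X + ι e * Y
    by-cases (yes u≅T) (yes u≅U) = contradiction (≅-trans (≅-sym u≅T) u≅U) T≇U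
    by-cases (yes u≅T) (no  u≇U) = trans (match-T L p q u≅T) (sym (trans (+-identityʳ _) (*-identityˡ X)))
    by-cases (no  u≇T) (yes u≅U) = trans (match-U L p q u≅U) (sym (*-identityˡ Y))
    by-cases (no  u≇T) (no  u≇U) = ι-no ((u ∷ L) ↭? mix p q) λ π → case ∈-mix p q π of λ
      { (inj₁ (u≅T , _)) → u≇T u≅T ; (inj₂ (u≅U , _)) → u≇U u≅U }

  -- A child contributes nothing, a copy of `T` or a copy of `U`: these are the three summands in
  -- the recursion of `G`.
  Wₗ-match : ∀ ts p q → Wₗ ts (λ L → ι (L ↭? mix p q)) ≡
             G p q (map (λ t → W t (occurs T) , W t (occurs U)) ts)
  Wₗ-match []       zero    zero    = refl
  Wₗ-match []       zero    (suc q) = refl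
  Wₗ-match []       (suc p) q       = refl
  Wₗ-match (t ∷ ts) p       q       = begin
    Wₗ (t ∷ ts) (λ L → ι (L ↭? mix p q))
      ≡⟨ Wₗ-∷ t ts (λ L → ι (L ↭? mix p q)) ⟩
    W t (λ m → Wₗ ts (λ L → ι ((m ?∷ L) ↭? mix p q)))
      ≡⟨ W-cong t inner ⟩
    W t (λ m → isNothing m * Γ p q + occurs T m * X + occurs U m * Y)
      ≡⟨ linear (isNothing ∘ induced t) (occurs T ∘ induced t) (occurs U ∘ induced t) (subsets ‖ t ‖) ⟩
    W t isNothing * Γ p q + W t (occurs T) * X + W t (occurs U) * Y
      ≡⟨ cong (λ r → r + W t (occurs T) * X + W t (occurs U) * Y)
           (trans (cong (_* Γ p q) (W-isNothing t)) (*-identityˡ (Γ p q))) ⟩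
    Γ p q + W t (occurs T) * X + W t (occurs U) * Y ∎
    where
    open ≡-Reasoning
    Γ : ℕ → ℕ → ℕ
    Γ p q = G p q (map (λ t → W t (occurs T) , W t (occurs U)) ts)
    X = onPred (λ p → Γ p q) p
    Y = onPred (λ q → Γ p q) q
    linear : ∀ {A : Set} (f g h : A → ℕ) (xs : List A) →
             ∑ (λ x → f x * Γ p q + g x * X + h x * Y) xs ≡ ∑ f xs * Γ p q + ∑ g xs * X + ∑ h xs * Y
    linear f g h xs = trans (∑-+ (λ x → f x * Γ p q + g x * X) _ xs)
      (cong₂ _+_ (trans (∑-+ (λ x → f x * Γ p q) _ xs) (cong₂ _+_ (∑-*ʳ f (Γ p q) xs) (∑-*ʳ g X xs))) (∑-*ʳ h Y xs))
    Wₗ-onPred : ∀ (f : ℕ → List Tree → ℕ) n → Wₗ ts (λ L → onPred (λ i → f i L) n) ≡ onPred (λ i → Wₗ ts (f i)) n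
    Wₗ-onPred f zero    = ∑-zero (subsets ‖ ts ‖ₗ)
    Wₗ-onPred f (suc n) = refl
    scaled : ∀ c (f : ℕ → List Tree → ℕ) g → (∀ i → Wₗ ts (f i) ≡ g i) → ∀ n →
             Wₗ ts (λ L → c * onPred (λ i → f i L) n) ≡ c * onPred g n
    scaled c f g h n = begin
      Wₗ ts (λ L → c * onPred (λ i → f i L) n)   ≡⟨ Wₗ-cong ts (λ L → *-comm c (onPred (λ i → f i L) n)) ⟩
      Wₗ ts (λ L → onPred (λ i → f i L) n * c)   ≡⟨ ∑-*ʳ (λ S → onPred (λ i → f i (inducedₗ ts S)) n) c (subsets ‖ ts ‖ₗ) ⟩
      Wₗ ts (λ L → onPred (λ i → f i L) n) * c   ≡⟨ cong (_* c) (trans (Wₗ-onPred f n) (onPred-cong h n)) ⟩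
      onPred g n * c                             ≡⟨ *-comm (onPred g n) c ⟩
      c * onPred g n                             ∎
    inner : ∀ m → Wₗ ts (λ L → ι ((m ?∷ L) ↭? mix p q)) ≡ isNothing m * Γ p q + occurs T m * X + occurs U m * Y
    inner nothing  = trans (Wₗ-match ts p q) (sym (trans (+-identityʳ _) (trans (+-identityʳ _) (*-identityˡ (Γ p q)))))
    inner (just u) = begin
      Wₗ ts (λ L → ι ((u ∷ L) ↭? mix p q))
        ≡⟨ Wₗ-cong ts (λ L → match-∷ u L p q) ⟩
      Wₗ ts (λ L → ι (u ≅? T) * onPred (λ p → ι (L ↭? mix p q)) p + ι (u ≅? U) * onPred (λ q → ι (L ↭? mix p q)) q)
        ≡⟨ ∑-+ (λ S → ι (u ≅? T) * onPred (λ p → ι (inducedₗ ts S ↭? mix p q)) p) _ (subsets ‖ ts ‖ₗ) ⟩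
      Wₗ ts (λ L → ι (u ≅? T) * onPred (λ p → ι (L ↭? mix p q)) p) + Wₗ ts (λ L → ι (u ≅? U) * onPred (λ q → ι (L ↭? mix p q)) q)
        ≡⟨ cong₂ _+_ (scaled (ι (u ≅? T)) (λ p L → ι (L ↭? mix p q)) (λ p → Γ p q) (λ p → Wₗ-match ts p q) p)
                     (scaled (ι (u ≅? U)) (λ q L → ι (L ↭? mix p q)) (λ q → Γ p q) (λ q → Wₗ-match ts p q) q) ⟩
      ι (u ≅? T) * X + ι (u ≅? U) * Y ∎

  -- By `root`, a copy either lies inside one child or has its branches in distinct children.
  -- `2 ≤ p + q` keeps the two cases apart, as a single induced branch cannot match all branches of
  -- `E`.
  copies-node : ∀ p q → 2 ≤ p + q → ∀ t ts → let E = node (mix p q) in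
                copies E (node (t ∷ ts)) ≡
                ∑ (copies E) (t ∷ ts) + G p q (map (λ t → copies T t , copies U t) (t ∷ ts))
  copies-node p q 2≤p+q t ts = begin
    copies E (node (t ∷ ts))
      ≡⟨ copies≡W E (node (t ∷ ts)) ⟩
    W (node (t ∷ ts)) (occurs E)
      ≡⟨ W-node t ts (occurs E) ⟩
    Wₗ (t ∷ ts) (occurs E ∘ root)
      ≡⟨ Wₗ-cong (t ∷ ts) split ⟩
    Wₗ (t ∷ ts) (λ L → isSingleton E L + ι (L ↭? mix p q))
      ≡⟨ ∑-+ (isSingleton E ∘ inducedₗ (t ∷ ts)) _ (subsets ‖ t ∷ ts ‖ₗ) ⟩
    Wₗ (t ∷ ts) (isSingleton E) + Wₗ (t ∷ ts) (λ L → ι (L ↭? mix p q))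
      ≡⟨ cong₂ _+_ (Wₗ-isSingleton E (t ∷ ts)) (Wₗ-match (t ∷ ts) p q) ⟩
    ∑ (λ t → W t (occurs E)) (t ∷ ts) + G p q (map (λ t → W t (occurs T) , W t (occurs U)) (t ∷ ts))
      ≡⟨ cong₂ _+_ (∑-cong (λ t → copies≡W E t) (t ∷ ts))
                   (cong (G p q) (map-cong (λ t → cong₂ _,_ (copies≡W T t) (copies≡W U t)) (t ∷ ts))) ⟨
    ∑ (copies E) (t ∷ ts) + G p q (map (λ t → copies T t , copies U t) (t ∷ ts)) ∎
    where
    open ≡-Reasoning
    E = node (mix p q)
    length-mix : length (mix p q) ≡ p + q
    length-mix = trans (length-++ (replicate p T)) (cong₂ _+_ (length-replicate p) (length-replicate q))
    short : ∀ L → length L < 2 → ι (L ↭? mix p q) ≡ 0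
    short L len = ι-no (L ↭? mix p q) λ π →
      <-irrefl refl (<-≤-trans len (subst (2 ≤_) (sym (trans (xs↭ys⇒|xs|≡|ys| π) length-mix)) 2≤p+q))
    split : ∀ L → occurs E (root L) ≡ isSingleton E L + ι (L ↭? mix p q)
    split []          = sym (short [] (s≤s z≤n))
    split (u ∷ [])    = sym (trans (cong (ι (u ≅? E) +_) (short (u ∷ []) ≤-refl)) (+-identityʳ _))
    split (u ∷ v ∷ L) = refl

mutual
  copies-leaf : ∀ T → copies leaf T ≡ ‖ T ‖
  copies-leaf leaf            = refl
  copies-leaf (node (t ∷ ts)) = begin
    copies leaf (node (t ∷ ts))                  ≡⟨ copies≡W leaf (node (t ∷ ts)) ⟩
    W (node (t ∷ ts)) (occurs leaf)              ≡⟨ W-node t ts (occurs leaf) ⟩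
    Wₗ (t ∷ ts) (occurs leaf ∘ root)
      ≡⟨ Wₗ-cong (t ∷ ts) occurs-root ⟩
    Wₗ (t ∷ ts) (isSingleton leaf)               ≡⟨ Wₗ-isSingleton leaf (t ∷ ts) ⟩
    ∑ (λ t → W t (occurs leaf)) (t ∷ ts)         ≡⟨ ∑-cong (λ t → copies≡W leaf t) (t ∷ ts) ⟨
    ∑ (copies leaf) (t ∷ ts)                     ≡⟨ ∑-copies-leaf (t ∷ ts) ⟩
    ‖ t ∷ ts ‖ₗ                                  ∎
    where
    open ≡-Reasoning
    occurs-root : ∀ L → occurs leaf (root L) ≡ isSingleton leaf L
    occurs-root []          = refl
    occurs-root (_ ∷ [])    = refl
    occurs-root (_ ∷ _ ∷ _) = refl

  ∑-copies-leaf : ∀ ts → ∑ (copies leaf) ts ≡ ‖ ts ‖ₗ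
  ∑-copies-leaf []       = refl
  ∑-copies-leaf (t ∷ ts) = cong₂ _+_ (copies-leaf t) (∑-copies-leaf ts)

-- Complete trees and the bounds passed from the branches to the whole tree

^-distribʳ-* : ∀ p m n → (m * n) ^ p ≡ m ^ p * n ^ p
^-distribʳ-* zero    m n = refl
^-distribʳ-* (suc p) m n = trans (cong (m * n *_) (^-distribʳ-* p m n)) ([m*n]*[o*p]≡[m*o]*[n*p] m n (m ^ p) (n ^ p))

complete : ℕ → ℕ → Tree
complete d zero    = leaf
complete d (suc h) = node (replicate d (complete d h))

∑-replicate : ∀ {A : Set} (f : A → ℕ) n x → ∑ f (replicate n x) ≡ n * f x
∑-replicate f zero    x = refl
∑-replicate f (suc n) x = cong (f x +_) (∑-replicate f n x)

∑-‖‖ : ∀ ts → ∑ ‖_‖ ts ≡ ‖ ts ‖ₗ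
∑-‖‖ []       = refl
∑-‖‖ (t ∷ ts) = cong (‖ t ‖ +_) (∑-‖‖ ts)

‖complete‖ : ∀ e h → let d = 2 + e in ‖ complete d h ‖ ≡ d ^ h
‖complete‖ e zero    = refl
‖complete‖ e (suc h) = begin
  ‖ replicate d (complete d h) ‖ₗ     ≡⟨ ∑-‖‖ (replicate d (complete d h)) ⟨
  ∑ ‖_‖ (replicate d (complete d h))  ≡⟨ ∑-replicate ‖_‖ d (complete d h) ⟩
  d * ‖ complete d h ‖                ≡⟨ cong (d *_) (‖complete‖ e h) ⟩
  d ^ suc h                           ∎
  where
  open ≡-Reasoning
  d = 2 + e

complete-dary : ∀ e h → IsDAry (2 + e) (complete (2 + e) h)
complete-dary e zero    = leaf-dary
complete-dary e (suc h) = node-dary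
  (s≤s (s≤s z≤n)) (≤-reflexive (length-replicate (2 + e))) (replicate⁺ (2 + e) (complete-dary e h))

-- Upper and Lower say that A / B bounds copies T X / ‖ X ‖ ^ s and that complete
-- trees attain this bound up to K / (B ‖ X ‖).
Upper : (d A B s : ℕ) → Tree → Set
Upper d A B s T = ∀ X → IsDAry d X → B * copies T X ≤ A * ‖ X ‖ ^ s

Approx : (d K A s : ℕ) → (ℕ → ℕ) → Set
Approx d K A s f = ∀ h → let n = d ^ h in A * n ^ suc s ≤ n * f h + K * n ^ s

Lower : (d K A B s : ℕ) → Tree → Set
Lower d K A B s T = Approx d K A s (λ h → B * copies T (complete d h))

Bounded : (d A s : ℕ) → (ℕ → ℕ) → Set
Bounded d A s f = ∀ h → f h ≤ A * (d ^ h) ^ s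

-- `Approx` says that f is at least A n^s - K n^(s-1), multiplied by n. The lower bounds are
-- inserted one factor at a time; the error of `f′` then comes multiplied by `f`, which is why `f`
-- must be bounded from above.
approx-* : ∀ {d K K′ A A′ s s′ f f′} → Bounded d A s f → Approx d K A s f → Approx d K′ A′ s′ f′ →
           Approx d (A * K′ + K * A′) (A * A′) (s + s′) (λ h → f h * f′ h)
approx-* {d} {K} {K′} {A} {A′} {s} {s′} {f} {f′} f≤ f≥ f′≥ h = begin
  A * A′ * n ^ suc (s + s′)
    ≡⟨ cong (λ r → A * A′ * (n * r)) (^-distribˡ-+-* n s s′) ⟩
  A * A′ * (n * (P * Q))
    ≡⟨ regroup₁ A A′ n P Q ⟩
  A * (n * P) * (A′ * Q)
    ≤⟨ *-monoˡ-≤ (A′ * Q) (f≥ h) ⟩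
  (n * f h + K * P) * (A′ * Q)
    ≡⟨ regroup₂ n (f h) K P A′ Q ⟩
  f h * (A′ * (n * Q)) + K * A′ * (P * Q)
    ≤⟨ +-monoˡ-≤ (K * A′ * (P * Q)) (*-monoʳ-≤ (f h) (f′≥ h)) ⟩
  f h * (n * f′ h + K′ * Q) + K * A′ * (P * Q)
    ≡⟨ cong (_+ K * A′ * (P * Q)) (*-distribˡ-+ (f h) (n * f′ h) (K′ * Q)) ⟩
  f h * (n * f′ h) + f h * (K′ * Q) + K * A′ * (P * Q)
    ≤⟨ +-monoˡ-≤ (K * A′ * (P * Q)) (+-monoʳ-≤ (f h * (n * f′ h)) (*-monoˡ-≤ (K′ * Q) (f≤ h))) ⟩
  f h * (n * f′ h) + A * P * (K′ * Q) + K * A′ * (P * Q)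
    ≡⟨ regroup₃ (f h) n (f′ h) A P K′ Q K A′ ⟩
  n * (f h * f′ h) + (A * K′ + K * A′) * (P * Q)
    ≡⟨ cong (λ r → n * (f h * f′ h) + (A * K′ + K * A′) * r) (^-distribˡ-+-* n s s′) ⟨
  n * (f h * f′ h) + (A * K′ + K * A′) * n ^ (s + s′) ∎
  where
  open ≤-Reasoning
  n = d ^ h
  P = n ^ s
  Q = n ^ s′
  regroup₁ : ∀ A A′ n P Q → A * A′ * (n * (P * Q)) ≡ A * (n * P) * (A′ * Q)
  regroup₁ = solve-∀
  regroup₂ : ∀ n f K P A′ Q → (n * f + K * P) * (A′ * Q) ≡ f * (A′ * (n * Q)) + K * A′ * (P * Q)
  regroup₂ = solve-∀
  regroup₃ : ∀ f n f′ A P K′ Q K A′ →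
             f * (n * f′) + A * P * (K′ * Q) + K * A′ * (P * Q) ≡ n * (f * f′) + (A * K′ + K * A′) * (P * Q)
  regroup₃ = solve-∀

-- Equal to p K A^(p-1), in the recursive form in which `approx-*` produces it.
powerError : (K A p : ℕ) → ℕ
powerError K A zero    = 0
powerError K A (suc p) = A * powerError K A p + K * A ^ p

powerError-0 : ∀ A p → powerError 0 A p ≡ 0
powerError-0 A zero    = refl
powerError-0 A (suc p) rewrite powerError-0 A p | *-zeroʳ A = refl

bounded-* : ∀ {d A A′ s s′ f f′} → Bounded d A s f → Bounded d A′ s′ f′ →
            Bounded d (A * A′) (s + s′) (λ h → f h * f′ h)
bounded-* {d} {A} {A′} {s} {s′} {f} {f′} f≤ f′≤ h = begin
  f h * f′ h                                     ≤⟨ *-mono-≤ (f≤ h) (f′≤ h) ⟩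
  A * (d ^ h) ^ s * (A′ * (d ^ h) ^ s′)          ≡⟨ [m*n]*[o*p]≡[m*o]*[n*p] A ((d ^ h) ^ s) A′ ((d ^ h) ^ s′) ⟩
  A * A′ * ((d ^ h) ^ s * (d ^ h) ^ s′)          ≡⟨ cong (A * A′ *_) (^-distribˡ-+-* (d ^ h) s s′) ⟨
  A * A′ * (d ^ h) ^ (s + s′)                    ∎
  where open ≤-Reasoning

bounded-^ : ∀ {d A s f} → Bounded d A s f → ∀ p → Bounded d (A ^ p) (p * s) (λ h → f h ^ p)
bounded-^ f≤ zero    h = ≤-refl
bounded-^ {d} {A} {s} {f} f≤ (suc p) h =
  bounded-* {d} {A} {A ^ p} {s} {p * s} {f} f≤ (bounded-^ {d} {A} {s} {f} f≤ p) h

approx-^ : ∀ {d K A s f} → Bounded d A s f → Approx d K A s f →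
           ∀ p → Approx d (powerError K A p) (A ^ p) (p * s) (λ h → f h ^ p)
approx-^ {d} f≤ f≥ zero h = ≤-reflexive (unit (d ^ h))
  where
  unit : ∀ n → 1 * (n * 1) ≡ n * 1 + 0
  unit = solve-∀
approx-^ {d} {K} {A} {s} {f} f≤ f≥ (suc p) h =
  approx-* {d} {K} {powerError K A p} {A} {A ^ p} {s} {p * s} {f} f≤ f≥ (approx-^ {d} {K} {A} {s} {f} f≤ f≥ p) h

d^k∸d+d : ∀ e k → let d = 2 + e in d ^ suc k ∸ d + d ≡ d ^ suc k
d^k∸d+d e k = m∸n+n≡m (m≤m*n (2 + e) ((2 + e) ^ k))
  where
  instance
    _ = m^n≢0 (2 + e) k

module _ {e k p q s : ℕ} (T U : Tree) (T≇U : ¬ T ≅ U) {A₁ B₁ A₂ B₂ : ℕ}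
         (split : EvenSplit (2 + e) (2 + k) p q s) (2≤p+q : 2 ≤ p + q)
         (upper₁ : Upper (2 + e) A₁ B₁ s T) (upper₂ : Upper (2 + e) A₂ B₂ (suc s) U) where

  private
    d = 2 + e
    D = d ^ (2 + k) ∸ d
    E = node (replicate p T ++ replicate q U)
    a = A₁ ^ p * A₂ ^ q
    b = B₁ ^ p * B₂ ^ q

  copies-in-leaf : copies E leaf ≡ 0
  copies-in-leaf = trans (copies≡W E leaf) (cong (_+ 0) (ι-no (leaf ≅? E) λ { (permute π) → impossible (xs↭ys⇒|xs|≡|ys| π) }))
    where
    impossible : ¬ 0 ≡ length (replicate p T ++ replicate q U)
    impossible 0≡ = contradiction 2≤p+q (<⇒≱ (s≤s (≤-trans (≤-reflexive (sym (trans 0≡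
      (trans (length-++ (replicate p T)) (cong₂ _+_ (length-replicate p) (length-replicate q)))))) z≤n)))

  mutual
    -- Copies inside one child are bounded by induction on the tree, and those spread over the
    -- children by `G-mono` from the bounds for `T` and `U`. The denominator `D` is what
    -- `power-mean-split` requires for both parts to fit under one constant.
    upper-step : Upper d ((d C q) * a) (D * b) (2 + k) E
    upper-step leaf leaf-dary =
      ≤-trans (≤-reflexive (trans (cong (D * b *_) copies-in-leaf) (*-zeroʳ (D * b)))) z≤n
    upper-step (node ts@(t ∷ ts′)) (node-dary 2≤ ≤d darys) = begin
      D * b * copies E (node ts)
        ≡⟨ cong (D * b *_) (copies-node T U T≇U p q 2≤p+q t ts′) ⟩
      D * b * (∑ (copies E) ts + G p q (map (λ t → copies T t , copies U t) ts))
        ≡⟨ regroup₁ D b (∑ (copies E) ts) _ ⟩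
      D * b * ∑ (copies E) ts + D * (b * G p q (map (λ t → copies T t , copies U t) ts))
        ≤⟨ +-mono-≤ (upper-step-∑ ts darys) (*-monoʳ-≤ D (G-mono (pointwise ts darys) p q)) ⟩
      (d C q) * a * sum (map (_^ (2 + k)) (map ‖_‖ ts)) + D * (a * G p q (map (powers s) (map ‖_‖ ts)))
        ≡⟨ regroup₂ (d C q) a _ D _ ⟩
      a * ((d C q) * sum (map (_^ (2 + k)) (map ‖_‖ ts)) + D * G p q (map (powers s) (map ‖_‖ ts)))
        ≤⟨ *-monoʳ-≤ a (power-mean-split split (map ‖_‖ ts) (≤-trans (≤-reflexive (length-map ‖_‖ ts)) ≤d)) ⟩
      a * ((d C q) * sum (map ‖_‖ ts) ^ (2 + k))
        ≡⟨ cong (λ r → a * ((d C q) * r ^ (2 + k))) (∑-‖‖ ts) ⟩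
      a * ((d C q) * ‖ node ts ‖ ^ (2 + k))
        ≡⟨ regroup₃ a (d C q) _ ⟩
      (d C q) * a * ‖ node ts ‖ ^ (2 + k) ∎
      where
      open ≤-Reasoning
      regroup₁ : ∀ D b x g → D * b * (x + g) ≡ D * b * x + D * (b * g)
      regroup₁ = solve-∀
      regroup₂ : ∀ c a x D g → c * a * x + D * (a * g) ≡ a * (c * x + D * g)
      regroup₂ = solve-∀
      regroup₃ : ∀ a c x → a * (c * x) ≡ c * a * x
      regroup₃ = solve-∀
      pointwise : ∀ ts → All (IsDAry d) ts →
                  Pointwise (λ (u , v) (u′ , v′) → B₁ * u ≤ A₁ * u′ × B₂ * v ≤ A₂ * v′)
                            (map (λ t → copies T t , copies U t) ts) (map (powers s) (map ‖_‖ ts))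
      pointwise []       []             = []
      pointwise (t ∷ ts) (dary ∷ darys) = (upper₁ t dary , upper₂ t dary) ∷ pointwise ts darys

    upper-step-∑ : ∀ ts → All (IsDAry d) ts →
                   D * b * ∑ (copies E) ts ≤ (d C q) * a * sum (map (_^ (2 + k)) (map ‖_‖ ts))
    upper-step-∑ []       []             = ≤-trans (≤-reflexive (*-zeroʳ (D * b))) z≤n
    upper-step-∑ (t ∷ ts) (dary ∷ darys) = begin
      D * b * (copies E t + ∑ (copies E) ts)
        ≡⟨ *-distribˡ-+ (D * b) (copies E t) _ ⟩
      D * b * copies E t + D * b * ∑ (copies E) ts
        ≤⟨ +-mono-≤ (upper-step t dary) (upper-step-∑ ts darys) ⟩
      (d C q) * a * ‖ t ‖ ^ (2 + k) + (d C q) * a * sum (map (_^ (2 + k)) (map ‖_‖ ts))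
        ≡⟨ *-distribˡ-+ ((d C q) * a) (‖ t ‖ ^ (2 + k)) _ ⟨
      (d C q) * a * (‖ t ‖ ^ (2 + k) + sum (map (_^ (2 + k)) (map ‖_‖ ts))) ∎
      where open ≤-Reasoning

  module _ {K₁ K₂ : ℕ} (lower₁ : Lower d K₁ A₁ B₁ s T) (lower₂ : Lower d K₂ A₂ B₂ (suc s) U) where

    private
      K′ = A₁ ^ p * powerError K₂ A₂ q + powerError K₁ A₁ p * A₂ ^ q
      A = (d C q) * a
      -- The summand `A` settles height 0, where a leaf may contain no copy at all; the other
      -- summand is the error that one more level creates.
      K = A + d * D * (d C q) * K′
      u v : ℕ → ℕ
      u h = B₁ * copies T (complete d h)
      v h = B₂ * copies U (complete d h)

      bounded : ∀ {A B s T} → Upper d A B s T → Bounded d A s (λ h → B * copies T (complete d h))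
      bounded {A} {B} {s} upper h =
        ≤-trans (upper (complete d h) (complete-dary e h)) (≤-reflexive (cong (λ n → A * n ^ s) (‖complete‖ e h)))

      product : Approx d K′ a (2 + k) (λ h → u h ^ p * v h ^ q)
      product = subst (λ k → Approx d K′ a k (λ h → u h ^ p * v h ^ q)) (split-size split)
        (approx-* {d} {powerError K₁ A₁ p} {powerError K₂ A₂ q} {A₁ ^ p} {A₂ ^ q} {p * s} {q * suc s}
          (bounded-^ {d} {A₁} {s} (bounded {A₁} {B₁} {s} {T} upper₁) p)
          (approx-^ {d} {K₁} {A₁} {s} (bounded {A₁} {B₁} {s} {T} upper₁) lower₁ p)
          (approx-^ {d} {K₂} {A₂} {suc s} (bounded {A₂} {B₂} {suc s} {U} upper₂) lower₂ q))

      growth : ∀ h → d * (D * b * copies E (complete d h)) + D * ((d C q) * (u h ^ p * v h ^ q)) ≤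
               D * b * copies E (complete d (suc h))
      growth h = begin
        d * (D * b * N) + D * ((d C q) * (u h ^ p * v h ^ q))
          ≡⟨ cong (λ r → d * (D * b * N) + D * ((d C q) * r))
               (cong₂ _*_ (^-distribʳ-* p B₁ _) (^-distribʳ-* q B₂ _)) ⟩
        d * (D * b * N) + D * ((d C q) * (B₁ ^ p * x ^ p * (B₂ ^ q * y ^ q)))
          ≡⟨ regroup d D N (d C q) (B₁ ^ p) (B₂ ^ q) (x ^ p) (y ^ q) ⟩
        D * b * (d * N + (d C q) * (x ^ p * y ^ q))
          ≤⟨ *-monoʳ-≤ (D * b) (+-monoʳ-≤ (d * N) (G-replicate split x y)) ⟩
        D * b * (d * N + G p q (replicate d (x , y)))
          ≡⟨ cong (D * b *_) (cong₂ _+_ (∑-replicate (copies E) d (complete d h))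
               (cong (G p q) (map-replicate (λ t → copies T t , copies U t) d (complete d h)))) ⟨
        D * b * (∑ (copies E) (replicate d (complete d h)) + G p q (map (λ t → copies T t , copies U t) (replicate d (complete d h))))
          ≡⟨ cong (D * b *_) (copies-node T U T≇U p q 2≤p+q (complete d h) (replicate (suc e) (complete d h))) ⟨
        D * b * copies E (complete d (suc h)) ∎
        where
        open ≤-Reasoning
        N = copies E (complete d h)
        x = copies T (complete d h)
        y = copies U (complete d h)
        regroup : ∀ d D N c B₁ B₂ x y → d * (D * (B₁ * B₂) * N) + D * (c * (B₁ * x * (B₂ * y))) ≡
                                        D * (B₁ * B₂) * (d * N + c * (x * y))
        regroup = solve-∀

    -- From one height to the next the inherited error costs `d * d * K`, while `d ^ (2 + k) * K` is
    -- allowed. For `1 ≤ k` the difference is at least `K`, enough to absorb the new error; for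
    -- `k = 0` it is zero, so the new error must vanish.
    lower-step : 1 ≤ k ⊎ K′ ≡ 0 → ∃[ K ] Lower d K ((d C q) * a) (D * b) (2 + k) E
    lower-step small = K , go
      where
      open ≤-Reasoning
      error : d * D * (d C q) * K′ + d * d * K ≤ K * (D + d)
      error = subst (λ r → d * D * (d C q) * K′ + d * d * K ≤ K * r) (sym (d^k∸d+d e (suc k))) (case small)
        where
        case : 1 ≤ k ⊎ K′ ≡ 0 → d * D * (d C q) * K′ + d * d * K ≤ K * d ^ (2 + k)
        case (inj₁ 1≤k) = begin
          d * D * (d C q) * K′ + d * d * K ≤⟨ +-monoˡ-≤ (d * d * K) (m≤n+m (d * D * (d C q) * K′) A) ⟩
          K + d * d * K                    ≡⟨ regroup K (d * d) ⟩
          K * (1 + d * d)                  ≤⟨ *-monoʳ-≤ K bound ⟩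
          K * d ^ (2 + k)                  ∎
          where
          regroup : ∀ K x → K + x * K ≡ K * (1 + x)
          regroup = solve-∀
          double : ∀ x → x + x ≡ x * 2
          double = solve-∀
          bound : 1 + d * d ≤ d ^ (2 + k)
          bound = begin
            1 + d * d         ≤⟨ +-monoˡ-≤ (d * d) (s≤s {n = (1 + e) + (1 + e) * d} z≤n) ⟩
            d * d + d * d     ≡⟨ double (d * d) ⟩
            d * d * 2         ≤⟨ *-monoʳ-≤ (d * d) (s≤s (s≤s z≤n)) ⟩
            d * d * d         ≡⟨ cong (d * d *_) (*-identityʳ d) ⟨
            d * d * d ^ 1     ≤⟨ *-monoʳ-≤ (d * d) (^-monoʳ-≤ d 1≤k) ⟩
            d * d * d ^ k     ≡⟨ *-assoc d d (d ^ k) ⟩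
            d ^ (2 + k)       ∎
        case (inj₂ K′≡0) = begin
          d * D * (d C q) * K′ + d * d * K ≡⟨ cong (_+ d * d * K) (trans (cong (d * D * (d C q) *_) K′≡0) (*-zeroʳ (d * D * (d C q)))) ⟩
          d * d * K                        ≡⟨ *-comm (d * d) K ⟩
          K * (d * d)                      ≤⟨ *-monoʳ-≤ K (m≤m*n (d * d) (d ^ k)) ⟩
          K * (d * d * d ^ k)              ≡⟨ cong (K *_) (*-assoc d d (d ^ k)) ⟩
          K * d ^ (2 + k)                  ∎
          where
          instance
            _ = m^n≢0 d k
      go : Lower d K A (D * b) (2 + k) E
      go zero    = begin
        A * 1 ^ (3 + k)                                 ≡⟨ cong (A *_) (^-zeroˡ (3 + k)) ⟩
        A * 1                                           ≤⟨ *-monoˡ-≤ 1 (m≤m+n A _) ⟩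
        K * 1                                           ≡⟨ cong (K *_) (^-zeroˡ (2 + k)) ⟨
        K * 1 ^ (2 + k)                                 ≤⟨ m≤n+m _ _ ⟩
        1 * (D * b * copies E leaf) + K * 1 ^ (2 + k)   ∎
      go (suc h) = begin
        A * (d * n) ^ (3 + k)
          ≡⟨ cong (λ r → A * (d * n * r)) [dn]^k ⟩
        A * (d * n * ((D + d) * P))
          ≡⟨ regroup₁ (d C q) a d n D P ⟩
        d * D * (d C q) * (a * (n * P)) + d * d * (A * (n * P))
          ≤⟨ +-mono-≤ (*-monoʳ-≤ (d * D * (d C q)) (product h)) (*-monoʳ-≤ (d * d) (go h)) ⟩
        d * D * (d C q) * (n * Y + K′ * P) + d * d * (n * M + K * P)
          ≡⟨ regroup₂ d D (d C q) n Y K′ P M K ⟩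
        d * n * (d * M + D * ((d C q) * Y)) + (d * D * (d C q) * K′ + d * d * K) * P
          ≤⟨ +-mono-≤ (*-monoʳ-≤ (d * n) (growth h)) (*-monoˡ-≤ P error) ⟩
        d * n * M′ + K * (D + d) * P
          ≡⟨ cong (d * n * M′ +_) (trans (*-assoc K (D + d) P) (cong (K *_) (sym [dn]^k))) ⟩
        d * n * M′ + K * (d * n) ^ (2 + k) ∎
        where
        n = d ^ h
        P = n ^ (2 + k)
        Y = u h ^ p * v h ^ q
        M = D * b * copies E (complete d h)
        M′ = D * b * copies E (complete d (suc h))
        [dn]^k : (d * n) ^ (2 + k) ≡ (D + d) * P
        [dn]^k = trans (^-distribʳ-* (2 + k) d n) (cong (_* P) (sym (d^k∸d+d e (suc k))))
        regroup₁ : ∀ c a d n D P → c * a * (d * n * ((D + d) * P)) ≡ d * D * c * (a * (n * P)) + d * d * (c * a * (n * P))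
        regroup₁ = solve-∀
        regroup₂ : ∀ d D c n Y K′ P M K → d * D * c * (n * Y + K′ * P) + d * d * (n * M + K * P) ≡
                                          d * n * (d * M + D * (c * Y)) + (d * D * c * K′ + d * d * K) * P
        regroup₂ = solve-∀

-- Asymptotics and rational limits

binomial*k! : ∀ {n k} → k ≤ n → (n C k) * k ! ≡ n P′ k
binomial*k! {n} {k} k≤n = *-cancelʳ-≡ _ _ ((n ∸ k) !) (begin
  (n C k) * k ! * (n ∸ k) !          ≡⟨ trans (*-assoc (n C k) (k !) _) (cong ((n C k) *_) (*-comm (k !) _)) ⟩
  (n C k) * ((n ∸ k) ! * k !)        ≡⟨ binomial-factorials k≤n ⟩
  n !                                ≡⟨ m/n*n≡m (∣-trans (n∣m*n (k !)) (k![n∸k]!∣n! k≤n)) ⟨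
  n ! / (n ∸ k) ! * (n ∸ k) !        ≡⟨ cong (_* (n ∸ k) !) (nP′k≡n!/[n∸k]! k≤n) ⟨
  (n P′ k) * (n ∸ k) !               ∎)
  where
  open ≡-Reasoning
  instance
    _ = (n ∸ k) !≢0

P′≤^ : ∀ n k → n P′ k ≤ n ^ k
P′≤^ n zero    = ≤-refl
P′≤^ n (suc k) = *-mono-≤ (m∸n≤m n k) (P′≤^ n k)

-- The falling factorial falls short of n^k by at most k² n^(k-1): a further factor `n ∸ k` in place
-- of `n` costs another `k`.
^≤P′ : ∀ n k → n ^ suc k ≤ n * (n P′ k) + k * k * n ^ k
^≤P′ n zero    = ≤-reflexive (sym (+-identityʳ _))
^≤P′ n (suc k) = begin
  n * n ^ suc k
    ≤⟨ *-monoˡ-≤ (n ^ suc k) (m≤n+m∸n n k) ⟩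
  (k + (n ∸ k)) * n ^ suc k
    ≡⟨ *-distribʳ-+ (n ^ suc k) k (n ∸ k) ⟩
  k * n ^ suc k + (n ∸ k) * n ^ suc k
    ≤⟨ +-monoʳ-≤ (k * n ^ suc k) (*-monoʳ-≤ (n ∸ k) (^≤P′ n k)) ⟩
  k * n ^ suc k + (n ∸ k) * (n * (n P′ k) + k * k * n ^ k)
    ≡⟨ regroup₁ (k * n ^ suc k) (n ∸ k) n (n P′ k) (k * k * n ^ k) ⟩
  n * ((n ∸ k) * (n P′ k)) + (k * n ^ suc k + (n ∸ k) * (k * k * n ^ k))
    ≤⟨ +-monoʳ-≤ (n * ((n ∸ k) * (n P′ k))) (+-monoʳ-≤ (k * n ^ suc k) (*-monoˡ-≤ (k * k * n ^ k) (m∸n≤m n k))) ⟩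
  n * ((n ∸ k) * (n P′ k)) + (k * n ^ suc k + n * (k * k * n ^ k))
    -- The slack `suc k` completes `k + k * k` to the square of `suc k`.
    ≤⟨ +-monoʳ-≤ (n * ((n ∸ k) * (n P′ k))) (m≤m+n _ (suc k * n ^ suc k)) ⟩
  n * ((n ∸ k) * (n P′ k)) + (k * n ^ suc k + n * (k * k * n ^ k) + suc k * n ^ suc k)
    ≡⟨ regroup₂ (n * ((n ∸ k) * (n P′ k))) k n (n ^ k) ⟩
  n * ((n ∸ k) * (n P′ k)) + suc k * suc k * n ^ suc k ∎
  where
  open ≤-Reasoning
  regroup₁ : ∀ a m n p b → a + m * (n * p + b) ≡ n * (m * p) + (a + m * b)
  regroup₁ = solve-∀
  regroup₂ : ∀ a k n p → a + (k * (n * p) + n * (k * k * p) + (1 + k) * (n * p)) ≡ a + (1 + k) * (1 + k) * (n * p)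
  regroup₂ = solve-∀

-- `n C k` is of order n^k / k!, so the extra factor `n` outgrows any constant. The threshold comes
-- from `^≤P′` after multiplication by `k !`.
binomial-large : ∀ k Z → ∃[ N ] ∀ n → N ≤ n → 1 ≤ n × k ≤ n × Z * n ^ k < n * (n C k)
binomial-large k Z = N , λ n N≤n →
  ≤-trans (m≤n+m 1 (k + (k * k + Z * k !))) N≤n ,
  ≤-trans (≤-trans (m≤m+n k (k * k + Z * k !)) (m≤m+n _ 1)) N≤n ,
  *-cancelʳ-< (k !) _ _ (large n N≤n)
  where
  N = k + (k * k + Z * k !) + 1
  large : ∀ n → N ≤ n → Z * n ^ k * k ! < n * (n C k) * k !
  large n N≤n = +-cancelʳ-< (k * k * n ^ k) _ _ (begin-strict
    Z * n ^ k * k ! + k * k * n ^ k              ≡⟨ regroup₁ Z (n ^ k) (k !) (k * k) ⟩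
    (k * k + Z * k !) * n ^ k                    <⟨ *-monoˡ-< (n ^ k) small ⟩
    n ^ suc k                                    ≤⟨ ^≤P′ n k ⟩
    n * (n P′ k) + k * k * n ^ k                 ≡⟨ cong (λ r → n * r + k * k * n ^ k) (binomial*k! k≤n) ⟨
    n * ((n C k) * k !) + k * k * n ^ k          ≡⟨ cong (_+ k * k * n ^ k) (*-assoc n (n C k) (k !)) ⟨
    n * (n C k) * k ! + k * k * n ^ k            ∎)
    where
    open ≤-Reasoning
    k≤n : k ≤ n
    k≤n = ≤-trans (≤-trans (m≤m+n k (k * k + Z * k !)) (m≤m+n _ 1)) N≤n
    1≤n : 1 ≤ n
    1≤n = ≤-trans (m≤n+m 1 (k + (k * k + Z * k !))) N≤n
    instance
      _ = m^n≢0 n k {{>-nonZero 1≤n}}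
    small : k * k + Z * k ! < n
    small = ≤-trans (≤-trans (≤-reflexive (+-comm 1 _)) (+-monoˡ-≤ 1 (m≤n+m (k * k + Z * k !) k))) N≤n
    regroup₁ : ∀ Z P f c → Z * P * f + c * P ≡ (c + Z * f) * P
    regroup₁ = solve-∀

module _ (num den k m : ℕ) (1≤den : 1 ≤ den) where

  private
    instance
      den≢0 = >-nonZero 1≤den

  -- For `X` copies the conclusion is X / (n C k) < k! num / den + 1 / m, with denominators cleared.
  -- The 1 / m absorbs the gap between n^k and the falling factorial.
  eventually-below : ∃[ N ] ∀ n → N ≤ n → 1 ≤ n × k ≤ n ×
    (∀ X → den * X ≤ num * n ^ k → X * den * m < k ! * num * m * (n C k) + (n C k) * den)
  eventually-below with binomial-large k (num * m * (k * k))
  ... | N , large = N , λ n N≤n → let 1≤n , k≤n , big = large n N≤n in 1≤n , k≤n , go n k≤n big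
    where
    go : ∀ n → k ≤ n → num * m * (k * k) * n ^ k < n * (n C k) →
         ∀ X → den * X ≤ num * n ^ k → X * den * m < k ! * num * m * (n C k) + (n C k) * den
    go n k≤n big X X≤ = *-cancelˡ-< n _ _ (begin-strict
      n * (X * den * m)                                      ≡⟨ regroup₁ n X den m ⟩
      n * m * (den * X)                                      ≤⟨ *-monoʳ-≤ (n * m) X≤ ⟩
      n * m * (num * n ^ k)                                  ≡⟨ regroup₂ n m num (n ^ k) ⟩
      num * m * n ^ suc k                                    ≤⟨ *-monoʳ-≤ (num * m) (^≤P′ n k) ⟩
      num * m * (n * (n P′ k) + k * k * n ^ k)               ≡⟨ regroup₃ num m n (n P′ k) (k * k) (n ^ k) ⟩
      n * (num * m * (n P′ k)) + num * m * (k * k) * n ^ k   <⟨ +-monoʳ-< (n * (num * m * (n P′ k))) big ⟩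
      n * (num * m * (n P′ k)) + n * (n C k)                 ≤⟨ +-monoʳ-≤ (n * (num * m * (n P′ k))) (*-monoʳ-≤ n (m≤m*n (n C k) den)) ⟩
      n * (num * m * (n P′ k)) + n * ((n C k) * den)         ≡⟨ cong (λ r → n * (num * m * r) + n * ((n C k) * den)) (binomial*k! k≤n) ⟨
      n * (num * m * ((n C k) * k !)) + n * ((n C k) * den)  ≡⟨ regroup₄ n num m (n C k) (k !) ((n C k) * den) ⟩
      n * (k ! * num * m * (n C k) + (n C k) * den)          ∎)
      where
      open ≤-Reasoning
      regroup₁ : ∀ n X den m → n * (X * den * m) ≡ n * m * (den * X)
      regroup₁ = solve-∀
      regroup₂ : ∀ n m num P → n * m * (num * P) ≡ num * m * (n * P)
      regroup₂ = solve-∀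
      regroup₃ : ∀ num m n p c P → num * m * (n * p + c * P) ≡ n * (num * m * p) + num * m * c * P
      regroup₃ = solve-∀
      regroup₄ : ∀ n num m c f x → n * (num * m * (c * f)) + n * x ≡ n * (f * num * m * c + x)
      regroup₄ = solve-∀

  -- The conclusion is k! num / den < X / (n C k) + 1 / m, with denominators cleared. The falling
  -- factorial is at most n^k, so 1 / m only has to absorb the error `K`.
  eventually-above : ∀ K → ∃[ N ] ∀ n → N ≤ n → 1 ≤ n × k ≤ n ×
    (∀ X → num * n ^ suc k ≤ n * (den * X) + K * n ^ k → k ! * num * m * (n C k) < X * den * m + den * (n C k))
  eventually-above K with binomial-large k (m * K)
  ... | N , large = N , λ n N≤n → let 1≤n , k≤n , big = large n N≤n in 1≤n , k≤n , go n k≤n big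
    where
    go : ∀ n → k ≤ n → m * K * n ^ k < n * (n C k) →
         ∀ X → num * n ^ suc k ≤ n * (den * X) + K * n ^ k → k ! * num * m * (n C k) < X * den * m + den * (n C k)
    go n k≤n big X ≤X = *-cancelˡ-< n _ _ (begin-strict
      n * (k ! * num * m * (n C k))                 ≡⟨ regroup₁ n (k !) num m (n C k) ⟩
      m * (num * (n * ((n C k) * k !)))             ≡⟨ cong (λ r → m * (num * (n * r))) (binomial*k! k≤n) ⟩
      m * (num * (n * (n P′ k)))                    ≤⟨ *-monoʳ-≤ m (*-monoʳ-≤ num (*-monoʳ-≤ n (P′≤^ n k))) ⟩
      m * (num * n ^ suc k)                         ≤⟨ *-monoʳ-≤ m ≤X ⟩
      m * (n * (den * X) + K * n ^ k)               ≡⟨ regroup₂ m n den X K (n ^ k) ⟩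
      n * (X * den * m) + m * K * n ^ k             <⟨ +-monoʳ-< (n * (X * den * m)) big ⟩
      n * (X * den * m) + n * (n C k)               ≤⟨ +-monoʳ-≤ (n * (X * den * m)) (*-monoʳ-≤ n (m≤n*m (n C k) den)) ⟩
      n * (X * den * m) + n * (den * (n C k))       ≡⟨ *-distribˡ-+ n (X * den * m) _ ⟨
      n * (X * den * m + den * (n C k))             ∎)
      where
      open ≤-Reasoning
      regroup₁ : ∀ n f num m c → n * (f * num * m * c) ≡ m * (num * (n * (c * f)))
      regroup₁ = solve-∀
      regroup₂ : ∀ m n den X K P → m * (n * (den * X) + K * P) ≡ n * (X * den * m) + m * K * P
      regroup₂ = solve-∀

fromℕ≡mkℚ : ∀ n → fromℕ n ≡ mkℚ (ℤ.+ n) 0 (Coprimality.sym (1-coprimeTo n))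
fromℕ≡mkℚ n = ℚ.normalize-coprime (Coprimality.sym (1-coprimeTo n))

toℚᵘ-fromℕ : ∀ n → toℚᵘ (fromℕ n) ≡ ℚᵘ.mkℚᵘ (ℤ.+ n) 0
toℚᵘ-fromℕ n = cong toℚᵘ (fromℕ≡mkℚ n)

fromℕ-+ : ∀ m n → fromℕ (m + n) ≡ fromℕ m ℚ.+ fromℕ n
fromℕ-+ m n = ℚ.toℚᵘ-injective (ℚᵘ.≃-trans (ℚᵘ.≃-reflexive (toℚᵘ-fromℕ (m + n)))
  (ℚᵘ.≃-sym (ℚᵘ.≃-trans (ℚ.toℚᵘ-homo-+ (fromℕ m) (fromℕ n))
    (ℚᵘ.≃-trans (ℚᵘ.≃-reflexive (cong₂ ℚᵘ._+_ (toℚᵘ-fromℕ m) (toℚᵘ-fromℕ n)))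
      (ℚᵘ.*≡* (cong (ℤ._* ℤ.1ℤ) (cong₂ ℤ._+_ (ℤ.*-identityʳ (ℤ.+ m)) (ℤ.*-identityʳ (ℤ.+ n)))))))))

fromℕ-* : ∀ m n → fromℕ (m * n) ≡ fromℕ m ℚ.* fromℕ n
fromℕ-* m n = ℚ.toℚᵘ-injective (ℚᵘ.≃-trans (ℚᵘ.≃-reflexive (toℚᵘ-fromℕ (m * n)))
  (ℚᵘ.≃-sym (ℚᵘ.≃-trans (ℚ.toℚᵘ-homo-* (fromℕ m) (fromℕ n))
    (ℚᵘ.≃-trans (ℚᵘ.≃-reflexive (cong₂ ℚᵘ._*_ (toℚᵘ-fromℕ m) (toℚᵘ-fromℕ n)))
      (ℚᵘ.*≡* (cong (ℤ._* ℤ.1ℤ) (sym (ℤ.pos-* m n))))))))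

fromℕ-^ : ∀ m n → fromℕ (m ^ n) ≡ fromℕ m ^ℚ n
fromℕ-^ m zero    = refl
fromℕ-^ m (suc n) = trans (fromℕ-* m (m ^ n)) (cong (fromℕ m ℚ.*_) (fromℕ-^ m n))

fromℕ-∸ : ∀ {m n} → n ≤ m → fromℕ (m ∸ n) ≡ fromℕ m ℚ.- fromℕ n
fromℕ-∸ {m} {n} n≤m = begin
  fromℕ (m ∸ n)                                ≡⟨ solve 2 (λ x y → x := x :+ y :- y) refl (fromℕ (m ∸ n)) (fromℕ n) ⟩
  fromℕ (m ∸ n) ℚ.+ fromℕ n ℚ.- fromℕ n        ≡⟨ cong (ℚ._- fromℕ n) (fromℕ-+ (m ∸ n) n) ⟨
  fromℕ (m ∸ n + n) ℚ.- fromℕ n                ≡⟨ cong (λ r → fromℕ r ℚ.- fromℕ n) (m∸n+n≡m n≤m) ⟩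
  fromℕ m ℚ.- fromℕ n                          ∎
  where
  open ≡-Reasoning
  open +-*-Solver

fromℕ-mono-< : ∀ {m n} → m < n → fromℕ m ℚ.< fromℕ n
fromℕ-mono-< {m} {n} m<n = subst₂ ℚ._<_ (sym (fromℕ≡mkℚ m)) (sym (fromℕ≡mkℚ n))
  (ℚ.*<* (subst₂ ℤ._<_ (sym (ℤ.*-identityʳ (ℤ.+ m))) (sym (ℤ.*-identityʳ (ℤ.+ n))) (ℤ.+<+ m<n)))

fromℕ-positive : ∀ {n} → 1 ≤ n → ℚ.Positive (fromℕ n)
fromℕ-positive 1≤n = ℚ.positive (fromℕ-mono-< 1≤n)

÷₀-cancel : ∀ p {n} → 1 ≤ n → (p ÷₀ fromℕ n) ℚ.* fromℕ n ≡ p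
÷₀-cancel p {n} 1≤n with fromℕ n ℚ.≟ 0ℚ
... | yes n≡0 = contradiction (sym n≡0) (ℚ.<⇒≢ (fromℕ-mono-< 1≤n))
... | no  n≢0 = trans (ℚ.*-assoc p (ℚ.1/ q) q) (trans (cong (p ℚ.*_) (ℚ.*-inverseˡ q)) (ℚ.*-identityʳ p))
  where
  q = fromℕ n
  instance
    _ = ℚ.≢-nonZero n≢0

-- The denominator of `ε` serves as `m`, because the numerator of `ε` is at least 1.
archimedean : ∀ {ε} → 0ℚ ℚ.< ε → ∃[ m ] 1 ≤ m × 1ℚ ℚ.≤ ε ℚ.* fromℕ m
archimedean {ε} 0<ε = go ε (ℚ.positive 0<ε)
  where
  go : ∀ ε → ℚ.Positive ε → ∃[ m ] 1 ≤ m × 1ℚ ℚ.≤ ε ℚ.* fromℕ m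
  go ε@(mkℚ ℤ.+[1+ a ] b _) pos = suc b , s≤s z≤n , ℚ.toℚᵘ-cancel-≤
    (ℚᵘ.≤-respʳ-≃
      (ℚᵘ.≃-sym (ℚᵘ.≃-trans (ℚ.toℚᵘ-homo-* ε (fromℕ (suc b))) (ℚᵘ.≃-reflexive (cong (toℚᵘ ε ℚᵘ.*_) (toℚᵘ-fromℕ (suc b))))))
      (ℚᵘ.*≤* (ℤ.+≤+ (begin
        1 * (suc b * 1)              ≡⟨ trans (*-identityˡ _) (*-identityʳ (suc b)) ⟩
        suc b                        ≤⟨ m≤n*m (suc b) (suc a) ⟩
        suc a * suc b                ≡⟨ *-identityʳ _ ⟨
        suc a * suc b * 1            ∎))))
    where open ≤-Reasoning

-- r = X / H, L = Y / B and ε ≥ 1 / m.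
<-cross : ∀ {r L ε} {H X B Y m : ℕ} → 1 ≤ H → 1 ≤ B → 1 ≤ m →
          r ℚ.* fromℕ H ≡ fromℕ X → L ℚ.* fromℕ B ≡ fromℕ Y → 1ℚ ℚ.≤ ε ℚ.* fromℕ m →
          Y * H * m < X * B * m + B * H → L ℚ.< r ℚ.+ ε
<-cross {r} {L} {ε} {H} {X} {B} {Y} {m} 1≤H 1≤B 1≤m rH LB εm h = ℚ.*-cancelʳ-<-nonNeg F (begin-strict
  L ℚ.* F                                   ≡⟨ regroup₁ L (fromℕ H) (fromℕ B) (fromℕ m) ⟩
  L ℚ.* fromℕ B ℚ.* (fromℕ H ℚ.* fromℕ m)   ≡⟨ cong (ℚ._* (fromℕ H ℚ.* fromℕ m)) LB ⟩
  fromℕ Y ℚ.* (fromℕ H ℚ.* fromℕ m)         ≡⟨ trans (sym (ℚ.*-assoc (fromℕ Y) (fromℕ H) (fromℕ m))) (sym (fromℕ-3 Y H m)) ⟩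
  fromℕ (Y * H * m)                         <⟨ fromℕ-mono-< h ⟩
  fromℕ (X * B * m + B * H)                 ≡⟨ trans (fromℕ-+ (X * B * m) (B * H)) (cong₂ ℚ._+_ (fromℕ-3 X B m) (fromℕ-* B H)) ⟩
  fromℕ X ℚ.* fromℕ B ℚ.* fromℕ m ℚ.+ BH    ≡⟨ cong₂ (λ x y → x ℚ.* fromℕ B ℚ.* fromℕ m ℚ.+ y) (sym rH) (sym (ℚ.*-identityˡ BH)) ⟩
  r ℚ.* fromℕ H ℚ.* fromℕ B ℚ.* fromℕ m ℚ.+ 1ℚ ℚ.* BH
    ≤⟨ ℚ.+-monoʳ-≤ (r ℚ.* fromℕ H ℚ.* fromℕ B ℚ.* fromℕ m) (ℚ.*-monoʳ-≤-nonNeg BH εm) ⟩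
  r ℚ.* fromℕ H ℚ.* fromℕ B ℚ.* fromℕ m ℚ.+ ε ℚ.* fromℕ m ℚ.* BH
    ≡⟨ regroup₂ r ε (fromℕ H) (fromℕ B) (fromℕ m) ⟩
  (r ℚ.+ ε) ℚ.* F                           ∎)
  where
  open ℚ.≤-Reasoning
  F = fromℕ H ℚ.* (fromℕ B ℚ.* fromℕ m)
  BH = fromℕ B ℚ.* fromℕ H
  instance
    H>0 = fromℕ-positive 1≤H
    B>0 = fromℕ-positive 1≤B
    m>0 = fromℕ-positive 1≤m
    F≥0 = ℚ.pos⇒nonNeg F {{ℚ.pos*pos⇒pos (fromℕ H) (fromℕ B ℚ.* fromℕ m) {{ℚ.pos*pos⇒pos (fromℕ B) (fromℕ m)}}}}
    BH≥0 = ℚ.pos⇒nonNeg BH {{ℚ.pos*pos⇒pos (fromℕ B) (fromℕ H)}}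
  fromℕ-3 : ∀ a b c → fromℕ (a * b * c) ≡ fromℕ a ℚ.* fromℕ b ℚ.* fromℕ c
  fromℕ-3 a b c = trans (fromℕ-* (a * b) c) (cong (ℚ._* fromℕ c) (fromℕ-* a b))
  open +-*-Solver
  regroup₁ : ∀ l c b m → l ℚ.* (c ℚ.* (b ℚ.* m)) ≡ l ℚ.* b ℚ.* (c ℚ.* m)
  regroup₁ = solve 4 (λ l c b m → l :* (c :* (b :* m)) := l :* b :* (c :* m)) refl
  regroup₂ : ∀ r e c b m → r ℚ.* c ℚ.* b ℚ.* m ℚ.+ e ℚ.* m ℚ.* (b ℚ.* c) ≡ (r ℚ.+ e) ℚ.* (c ℚ.* (b ℚ.* m))
  regroup₂ = solve 5 (λ r e c b m → r :* c :* b :* m :+ e :* m :* (b :* c) := (r :+ e) :* (c :* (b :* m))) refl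

-- The induction over even trees

∑-replicate-‖‖ : ∀ n T → ‖ replicate n T ‖ₗ ≡ n * ‖ T ‖
∑-replicate-‖‖ n T = trans (sym (∑-‖‖ (replicate n T))) (∑-replicate ‖_‖ n T)

‖node‖ : ∀ ts → 1 ≤ length ts → ‖ node ts ‖ ≡ ‖ ts ‖ₗ
‖node‖ (t ∷ ts) _ = refl

‖‖ₗ-++ : ∀ ts us → ‖ ts ++ us ‖ₗ ≡ ‖ ts ‖ₗ + ‖ us ‖ₗ
‖‖ₗ-++ []       us = refl
‖‖ₗ-++ (t ∷ ts) us = trans (cong (‖ t ‖ +_) (‖‖ₗ-++ ts us)) (sym (+-assoc (‖ t ‖) (‖ ts ‖ₗ) (‖ us ‖ₗ)))

-- Besides identifying the denominator of `γ`, this tells the two kinds of branches apart: even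
-- trees with s and s + 1 leaves cannot be isomorphic.
even-size : ∀ {d k E} → IsEven d k E → ‖ E ‖ ≡ k
even-size single = refl
even-size (star {k} 2≤k k≤d) = begin
  ‖ node (replicate k leaf) ‖     ≡⟨ ‖node‖ (replicate k leaf) (≤-trans (s≤s z≤n) (≤-trans 2≤k (≤-reflexive (sym (length-replicate k))))) ⟩
  ‖ replicate k leaf ‖ₗ           ≡⟨ ∑-replicate-‖‖ k leaf ⟩
  k * 1                           ≡⟨ *-identityʳ k ⟩
  k                               ∎
  where open ≡-Reasoning
even-size {d} (branch {s} {b} {T} {U} b<d _ evenT evenU) = begin
  ‖ node (replicate (d ∸ b) T ++ replicate b U) ‖
    ≡⟨ ‖node‖ (replicate (d ∸ b) T ++ replicate b U) (≤-trans (m<n⇒0<n∸m b<d) (≤-trans (m≤m+n (d ∸ b) b)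
         (≤-reflexive (sym (trans (length-++ (replicate (d ∸ b) T)) (cong₂ _+_ (length-replicate (d ∸ b)) (length-replicate b))))))) ⟩
  ‖ replicate (d ∸ b) T ++ replicate b U ‖ₗ
    ≡⟨ ‖‖ₗ-++ (replicate (d ∸ b) T) (replicate b U) ⟩
  ‖ replicate (d ∸ b) T ‖ₗ + ‖ replicate b U ‖ₗ
    ≡⟨ cong₂ _+_ (trans (∑-replicate-‖‖ (d ∸ b) T) (cong ((d ∸ b) *_) (even-size evenT)))
                 (trans (∑-replicate-‖‖ b U) (cong (b *_) (even-size evenU))) ⟩
  (d ∸ b) * s + b * suc s
    ≡⟨ regroup (d ∸ b) b s ⟩
  (d ∸ b + b) * s + b
    ≡⟨ cong (λ r → r * s + b) (m∸n+n≡m (<⇒≤ b<d)) ⟩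
  d * s + b ∎
  where
  open ≡-Reasoning
  regroup : ∀ p b s → p * s + b * (1 + s) ≡ (p + b) * s + b
  regroup = solve-∀

-- copies E X ≤ (num / den) ‖ X ‖ ^ k, with asymptotic equality for complete
-- trees, where num / den = c.
record Asymptotics (d : ℕ) (c : ℚ) (k : ℕ) (E : Tree) : Set where
  field
    num den : ℕ
    1≤den   : 1 ≤ den
    value   : c ℚ.* fromℕ den ≡ fromℕ num
    upper   : Upper d num den k E
    error   : ℕ
    lower   : Lower d error num den k E

*-fractions : ∀ {x y : ℚ} {A B A′ B′} → x ℚ.* fromℕ B ≡ fromℕ A → y ℚ.* fromℕ B′ ≡ fromℕ A′ →
              x ℚ.* y ℚ.* fromℕ (B * B′) ≡ fromℕ (A * A′)
*-fractions {x} {y} {A} {B} {A′} {B′} xB yB′ = begin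
  x ℚ.* y ℚ.* fromℕ (B * B′)                   ≡⟨ cong (x ℚ.* y ℚ.*_) (fromℕ-* B B′) ⟩
  x ℚ.* y ℚ.* (fromℕ B ℚ.* fromℕ B′)           ≡⟨ solve 4 (λ x y b c → x :* y :* (b :* c) := (x :* b) :* (y :* c)) refl x y (fromℕ B) (fromℕ B′) ⟩
  x ℚ.* fromℕ B ℚ.* (y ℚ.* fromℕ B′)           ≡⟨ cong₂ ℚ._*_ xB yB′ ⟩
  fromℕ A ℚ.* fromℕ A′                         ≡⟨ fromℕ-* A A′ ⟨
  fromℕ (A * A′)                               ∎
  where
  open ≡-Reasoning
  open +-*-Solver

^-fraction : ∀ {x : ℚ} {A B} → x ℚ.* fromℕ B ≡ fromℕ A → ∀ p → x ^ℚ p ℚ.* fromℕ (B ^ p) ≡ fromℕ (A ^ p)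
^-fraction         xB zero    = refl
^-fraction {x} {A} {B} xB (suc p) =
  *-fractions {x} {x ^ℚ p} {A} {B} {A ^ p} {B ^ p} xB (^-fraction {x} {A} {B} xB p)

1≤^ : ∀ {n} → 1 ≤ n → ∀ p → 1 ≤ n ^ p
1≤^ {n} 1≤n p = m^n>0 n {{>-nonZero 1≤n}} p

module _ {e k p q s : ℕ} (T U : Tree) (T≇U : ¬ T ≅ U) {A₁ B₁ A₂ B₂ K₁ K₂ : ℕ}
         (split : EvenSplit (2 + e) (2 + k) p q s) (2≤p+q : 2 ≤ p + q)
         (upper₁ : Upper (2 + e) A₁ B₁ s T) (upper₂ : Upper (2 + e) A₂ B₂ (suc s) U)
         (lower₁ : Lower (2 + e) K₁ A₁ B₁ s T) (lower₂ : Lower (2 + e) K₂ A₂ B₂ (suc s) U)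
         where

  private
    d = 2 + e
    D = d ^ (2 + k) ∸ d

  -- `z` is the product of powers in the recursion of the constants, so that stars, where it is 1,
  -- and larger even trees share this step.
  asymptotics-step : ∀ {c z} → 1 ≤ k ⊎ A₁ ^ p * powerError K₂ A₂ q + powerError K₁ A₁ p * A₂ ^ q ≡ 0 →
                     1 ≤ B₁ ^ p * B₂ ^ q → z ℚ.* fromℕ (B₁ ^ p * B₂ ^ q) ≡ fromℕ (A₁ ^ p * A₂ ^ q) →
                     c ≡ fromℕ (d C q) ℚ.* (z ÷₀ (fromℕ d ^ℚ (2 + k) ℚ.- fromℕ d)) →
                     Asymptotics d c (2 + k) (node (replicate p T ++ replicate q U))
  asymptotics-step {c} {z} small 1≤b zb c-rec = record
    { num   = (d C q) * (A₁ ^ p * A₂ ^ q)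
    ; den   = D * (B₁ ^ p * B₂ ^ q)
    ; 1≤den = *-mono-≤ 1≤D 1≤b
    ; value = value
    ; upper = upper-step T U T≇U split 2≤p+q upper₁ upper₂
    ; error = proj₁ lower
    ; lower = proj₂ lower
    }
    where
    lower = lower-step T U T≇U split 2≤p+q upper₁ upper₂ {K₁} {K₂} lower₁ lower₂ small
    d<d^k : d < d ^ (2 + k)
    d<d^k = begin-strict
      d              ≡⟨ *-identityʳ d ⟨
      d ^ 1          <⟨ ^-monoʳ-< d (s≤s (s≤s z≤n)) (s≤s (s≤s (z≤n {k}))) ⟩
      d ^ (2 + k)    ∎
      where open ≤-Reasoning
    1≤D : 1 ≤ D
    1≤D = m<n⇒0<n∸m d<d^k
    D-value : fromℕ d ^ℚ (2 + k) ℚ.- fromℕ d ≡ fromℕ D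
    D-value = trans (cong (ℚ._- fromℕ d) (sym (fromℕ-^ d (2 + k)))) (sym (fromℕ-∸ {d ^ (2 + k)} {d} (<⇒≤ d<d^k)))
    value : c ℚ.* fromℕ (D * (B₁ ^ p * B₂ ^ q)) ≡ fromℕ ((d C q) * (A₁ ^ p * A₂ ^ q))
    value = begin
      c ℚ.* fromℕ (D * b)
        ≡⟨ cong₂ ℚ._*_ (trans c-rec (cong (λ r → fromℕ (d C q) ℚ.* (z ÷₀ r)) D-value)) (fromℕ-* D b) ⟩
      fromℕ (d C q) ℚ.* (z ÷₀ fromℕ D) ℚ.* (fromℕ D ℚ.* fromℕ b)
        ≡⟨ solve 4 (λ n w x y → n :* w :* (x :* y) := n :* (w :* x :* y)) refl (fromℕ (d C q)) (z ÷₀ fromℕ D) (fromℕ D) (fromℕ b) ⟩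
      fromℕ (d C q) ℚ.* ((z ÷₀ fromℕ D) ℚ.* fromℕ D ℚ.* fromℕ b)
        ≡⟨ cong (λ r → fromℕ (d C q) ℚ.* (r ℚ.* fromℕ b)) (÷₀-cancel z 1≤D) ⟩
      fromℕ (d C q) ℚ.* (z ℚ.* fromℕ b)
        ≡⟨ cong (fromℕ (d C q) ℚ.*_) zb ⟩
      fromℕ (d C q) ℚ.* fromℕ (A₁ ^ p * A₂ ^ q)
        ≡⟨ fromℕ-* (d C q) _ ⟨
      fromℕ ((d C q) * (A₁ ^ p * A₂ ^ q)) ∎
      where
      open ≡-Reasoning
      open +-*-Solver
      b = B₁ ^ p * B₂ ^ q

1^ℚ : ∀ n → 1ℚ ^ℚ n ≡ 1ℚ
1^ℚ zero    = refl
1^ℚ (suc n) = trans (ℚ.*-identityˡ (1ℚ ^ℚ n)) (1^ℚ n)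

leaf-upper : ∀ {d} → Upper d 1 1 1 leaf
leaf-upper X _ = ≤-reflexive (trans (cong (1 *_) (copies-leaf X)) (cong (1 *_) (sym (*-identityʳ ‖ X ‖))))

leaf-lower : ∀ {e} → Lower (2 + e) 0 1 1 1 leaf
leaf-lower {e} h = ≤-reflexive (trans (regroup (d ^ h))
  (cong (λ r → d ^ h * (1 * r) + 0) (sym (trans (copies-leaf (complete d h)) (‖complete‖ e h)))))
  where
  d = 2 + e
  regroup : ∀ n → 1 * (n * (n * 1)) ≡ n * (1 * n) + 0
  regroup = solve-∀

module _ {e : ℕ} (c : ℕ → ℚ) (constants : IsEvenConstants (2 + e) c) where
  open IsEvenConstants constants

  private
    d = 2 + e

  -- The recursion reaches a star with `k < d` leaves as `s = 0`, `b = k`, but the one with `d`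
  -- leaves as `s = 1`, `b = 0`. Since `d C 0` and `d C d` agree, both follow the formula for
  -- `s = 0`, which is how `EvenSplit` treats stars.
  star-constant : ∀ k → 2 ≤ k → k ≤ d →
                  c k ≡ fromℕ (d C k) ℚ.* (1ℚ ÷₀ (fromℕ d ^ℚ k ℚ.- fromℕ d))
  star-constant k 2≤k k≤d with k ≟ d
  ... | no k≢d = begin
    c k                ≡⟨ cong c k≡ ⟨
    c (d * 0 + k)      ≡⟨ c-rec 0 k (≤∧≢⇒< k≤d k≢d) (subst (2 ≤_) (sym k≡) 2≤k) ⟩
    fromℕ (d C k) ℚ.* ((c 0 ^ℚ (d ∸ k) ℚ.* c 1 ^ℚ k) ÷₀ (fromℕ d ^ℚ (d * 0 + k) ℚ.- fromℕ d))
      ≡⟨ cong₂ (λ x y → fromℕ (d C k) ℚ.* (x ÷₀ (fromℕ d ^ℚ y ℚ.- fromℕ d)))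
           (cong₂ ℚ._*_ (trans (cong (_^ℚ (d ∸ k)) c₀) (1^ℚ (d ∸ k))) (trans (cong (_^ℚ k) c₁) (1^ℚ k))) k≡ ⟩
    fromℕ (d C k) ℚ.* (1ℚ ÷₀ (fromℕ d ^ℚ k ℚ.- fromℕ d)) ∎
    where
    open ≡-Reasoning
    k≡ : d * 0 + k ≡ k
    k≡ = cong (_+ k) (*-zeroʳ d)
  ... | yes refl = begin
    c d                ≡⟨ cong c d≡ ⟨
    c (d * 1 + 0)      ≡⟨ c-rec 1 0 (s≤s z≤n) (subst (2 ≤_) (sym d≡) 2≤k) ⟩
    fromℕ (d C 0) ℚ.* ((c 1 ^ℚ d ℚ.* 1ℚ) ÷₀ (fromℕ d ^ℚ (d * 1 + 0) ℚ.- fromℕ d))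
      ≡⟨ cong₂ (λ x y → fromℕ (d C 0) ℚ.* (x ÷₀ (fromℕ d ^ℚ y ℚ.- fromℕ d)))
           (cong (ℚ._* 1ℚ) (trans (cong (_^ℚ d) c₁) (1^ℚ d))) d≡ ⟩
    fromℕ (d C 0) ℚ.* (1ℚ ÷₀ (fromℕ d ^ℚ d ℚ.- fromℕ d))
      ≡⟨ cong (λ r → fromℕ r ℚ.* (1ℚ ÷₀ (fromℕ d ^ℚ d ℚ.- fromℕ d))) (sym (nCn≡1 d)) ⟩
    fromℕ (d C d) ℚ.* (1ℚ ÷₀ (fromℕ d ^ℚ d ℚ.- fromℕ d)) ∎
    where
    open ≡-Reasoning
    d≡ : d * 1 + 0 ≡ d
    d≡ = trans (+-identityʳ (d * 1)) (*-identityʳ d)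

  asymptotics : ∀ {k E} → IsEven d k E → Asymptotics d (c k) k E
  asymptotics single = record
    { num = 1 ; den = 1 ; 1≤den = ≤-refl ; value = cong (ℚ._* 1ℚ) c₁
    ; upper = leaf-upper {d} ; error = 0 ; lower = leaf-lower }
  asymptotics (star {suc zero} (s≤s ()) _)
  asymptotics (star {suc (suc k)} 2≤k k≤d) =
    -- Since p = 0, any tree other than leaf can play the role of T, with 0 / 0
    -- as its bound.
    asymptotics-step (node (leaf ∷ leaf ∷ [])) leaf (λ e → contradiction (‖‖-cong e) λ ())
      {A₁ = 0} {B₁ = 0} {K₁ = 0} (star k≤d) 2≤k
      (λ _ _ → z≤n) (leaf-upper {d}) (λ _ → z≤n) leaf-lower
      (inj₂ (trans (cong (λ r → 1 * r + 0) (powerError-0 1 (2 + k))) refl))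
      (≤-reflexive (sym ones)) (trans (cong (λ r → 1ℚ ℚ.* fromℕ r) ones) (cong fromℕ (sym ones)))
      (star-constant (2 + k) 2≤k k≤d)
    where
    ones : 1 * 1 ^ (2 + k) ≡ 1
    ones = trans (*-identityˡ _) (^-zeroˡ (2 + k))
  asymptotics (branch {s} {b} {T} {U} b<d d<k evenT evenU) =
    -- More than `d ≥ 2` leaves means degree at least 3, which gives `lower-step` its room for the
    -- error.
    go (d * s + b) (≤-trans (s≤s (s≤s (s≤s z≤n))) d<k)
       (subst (λ k → EvenSplit d k (d ∸ b) b s) (+-comm b (d * s)) (branch (m∸n+n≡m (<⇒≤ b<d))))
       (c-rec s b b<d (≤-trans (s≤s (s≤s z≤n)) d<k))
    where
    module T = Asymptotics (asymptotics evenT)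
    module U = Asymptotics (asymptotics evenU)
    T≇U : ¬ T ≅ U
    T≇U e = contradiction (trans (sym (even-size evenT)) (trans (‖‖-cong e) (even-size evenU))) (1+n≢n ∘ sym)
    go : ∀ k → 3 ≤ k → EvenSplit d k (d ∸ b) b s →
         c k ≡ fromℕ (d C b) ℚ.* ((c s ^ℚ (d ∸ b) ℚ.* c (suc s) ^ℚ b) ÷₀ (fromℕ d ^ℚ k ℚ.- fromℕ d)) →
         Asymptotics d (c k) k (node (replicate (d ∸ b) T ++ replicate b U))
    go (suc (suc k)) (s≤s (s≤s 1≤k)) split rec =
      asymptotics-step T U T≇U {T.num} {T.den} {U.num} {U.den} {T.error} {U.error} split (≤-trans (s≤s (s≤s z≤n)) (≤-reflexive (sym (m∸n+n≡m (<⇒≤ b<d)))))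
        T.upper U.upper T.lower U.lower (inj₁ 1≤k)
        (*-mono-≤ (1≤^ T.1≤den (d ∸ b)) (1≤^ U.1≤den b))
        (*-fractions {c s ^ℚ (d ∸ b)} {c (suc s) ^ℚ b} {T.num ^ (d ∸ b)} {T.den ^ (d ∸ b)} {U.num ^ b} {U.den ^ b}
          (^-fraction {c s} {T.num} {T.den} T.value (d ∸ b)) (^-fraction {c (suc s)} {U.num} {U.den} U.value b))
        rec

-- Existence of the maximum density

mutual
  isDAry? : ∀ d T → Dec (IsDAry d T)
  isDAry? d leaf            = yes leaf-dary
  isDAry? d (node (t ∷ ts)) =
    map′ (λ { (2≤ , ≤d , h) → node-dary 2≤ ≤d h }) (λ { (node-dary 2≤ ≤d h) → 2≤ , ≤d , h })
         (2 ≤? length (t ∷ ts) ×-dec length (t ∷ ts) ≤? d ×-dec allDAry? d (t ∷ ts))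

  allDAry? : ∀ d ts → Dec (All (IsDAry d) ts)
  allDAry? d []       = yes []
  allDAry? d (t ∷ ts) = map′ (λ (h , hs) → h ∷ hs) (λ { (h ∷ hs) → h , hs }) (isDAry? d t ×-dec allDAry? d ts)

listsUpTo : {A : Set} → ℕ → List A → List (List A)
listsUpTo zero    xs = [] ∷ []
listsUpTo (suc n) xs = [] ∷ cartesianProductWith _∷_ xs (listsUpTo n xs)

∈-listsUpTo : {A : Set} {n : ℕ} {xs ys : List A} → length ys ≤ n → All (_∈ xs) ys → ys ∈ listsUpTo n xs
∈-listsUpTo {n = zero}  {ys = []}    _       []       = here refl
∈-listsUpTo {n = suc n} {ys = []}    _       []       = here refl
∈-listsUpTo {n = suc n} {ys = _ ∷ _} (s≤s l) (h ∷ hs) = there (∈-cartesianProductWith⁺ _∷_ h (∈-listsUpTo l hs))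

-- A finite list in which all d-ary trees with at most `suc h` leaves occur, so that a maximum over
-- trees of a given size becomes a maximum over a list. Lists that do not form d-ary trees are
-- filtered out later.
treesOfHeight≤ : ℕ → ℕ → List Tree
treesOfHeight≤ d zero    = leaf ∷ []
treesOfHeight≤ d (suc h) = leaf ∷ map node (listsUpTo d (treesOfHeight≤ d h))

mutual
  1≤‖‖ : ∀ T → 1 ≤ ‖ T ‖
  1≤‖‖ leaf            = ≤-refl
  1≤‖‖ (node (t ∷ ts)) = ≤-trans (1≤‖‖ t) (m≤m+n (‖ t ‖) (‖ ts ‖ₗ))

  length≤‖‖ₗ : ∀ ts → length ts ≤ ‖ ts ‖ₗ
  length≤‖‖ₗ []       = z≤n
  length≤‖‖ₗ (t ∷ ts) = +-mono-≤ (1≤‖‖ t) (length≤‖‖ₗ ts)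

mutual
  ∈-treesOfHeight≤ : ∀ {d} h {T} → IsDAry d T → ‖ T ‖ ≤ suc h → T ∈ treesOfHeight≤ d h
  ∈-treesOfHeight≤ zero    leaf-dary _ = here refl
  ∈-treesOfHeight≤ (suc h) leaf-dary _ = here refl
  ∈-treesOfHeight≤ zero    {node (t ∷ ts)} (node-dary 2≤ ≤d darys) ‖T‖≤ =
    contradiction (≤-trans 2≤ (≤-trans (length≤‖‖ₗ (t ∷ ts)) ‖T‖≤)) λ { (s≤s ()) }
  ∈-treesOfHeight≤ (suc h) {node (t ∷ ts)} (node-dary (s≤s 1≤) ≤d darys) ‖T‖≤ =
    there (∈-map⁺ node (∈-listsUpTo ≤d (children h (length ts) 1≤ darys (small-children ‖T‖≤))))
    where
    small-children : ‖ t ∷ ts ‖ₗ ≤ suc (suc h) → All (λ u → ‖ u ‖ + length ts ≤ suc (suc h)) (t ∷ ts)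
    small-children ≤h = All.map (λ le → ≤-trans le ≤h) (child-sizes t ts)

  children : ∀ {d} h m → 1 ≤ m → ∀ {ts} → All (IsDAry d) ts → All (λ u → ‖ u ‖ + m ≤ suc (suc h)) ts →
             All (_∈ treesOfHeight≤ d h) ts
  children h m 1≤m []             []        = []
  children h m 1≤m {t ∷ _} (dary ∷ darys) (le ∷ les) =
    ∈-treesOfHeight≤ h dary (s≤s⁻¹ (≤-trans (≤-trans (≤-reflexive (+-comm 1 ‖ t ‖)) (+-monoʳ-≤ ‖ t ‖ 1≤m)) le))
    ∷ children h m 1≤m darys les

  -- Every sibling of `u` has at least one leaf. With at least one sibling, a child thus has fewer
  -- leaves than its parent, which bounds the height by the number of leaves.
  child-sizes : ∀ t ts → All (λ u → ‖ u ‖ + length ts ≤ ‖ t ∷ ts ‖ₗ) (t ∷ ts)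
  child-sizes t []        = ≤-refl ∷ []
  child-sizes t (t′ ∷ ts) = +-monoʳ-≤ ‖ t ‖ (length≤‖‖ₗ (t′ ∷ ts)) ∷ All.map (λ {u} → widen {u}) (child-sizes t′ ts)
    where
    widen : ∀ {u} → ‖ u ‖ + length ts ≤ ‖ t′ ∷ ts ‖ₗ → ‖ u ‖ + suc (length ts) ≤ ‖ t ‖ + ‖ t′ ∷ ts ‖ₗ
    widen {u} le = ≤-trans (≤-reflexive (+-suc ‖ u ‖ (length ts))) (+-mono-≤ (1≤‖‖ t) le)

-- Supplies a d-ary tree of each size for every `d ≥ 2`, so the maximum is taken over a nonempty
-- set.
caterpillar : ℕ → Tree
caterpillar zero    = leaf
caterpillar (suc n) = node (leaf ∷ caterpillar n ∷ [])

‖caterpillar‖ : ∀ n → ‖ caterpillar n ‖ ≡ suc n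
‖caterpillar‖ zero    = refl
‖caterpillar‖ (suc n) = cong suc (trans (+-identityʳ _) (‖caterpillar‖ n))

caterpillar-dary : ∀ {d} → 2 ≤ d → ∀ n → IsDAry d (caterpillar n)
caterpillar-dary 2≤d zero    = leaf-dary
caterpillar-dary 2≤d (suc n) = node-dary ≤-refl 2≤d (leaf-dary ∷ caterpillar-dary 2≤d n ∷ [])

module _ {d : ℕ} (2≤d : 2 ≤ d) (f : Tree → ℚ) where

  private
    candidates : ℕ → List Tree
    candidates n = filter (λ T → isDAry? d T ×-dec ‖ T ‖ ≟ suc n) (treesOfHeight≤ d n)

    best : ℕ → Tree
    best n = argmax f (caterpillar n) (candidates n)

  tree-maximum : Σ[ a ∈ (ℕ → ℚ) ] (∀ n → 1 ≤ n → IsMaximum (λ q → ∃[ T ] IsDAry d T × ‖ T ‖ ≡ n × f T ≡ q) (a n))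
  tree-maximum = f ∘ best ∘ pred , λ { (suc n) _ → attained n , λ { _ (T , dary , size , refl) → maximal n dary size } }
    where
    attained : ∀ n → ∃[ T ] IsDAry d T × ‖ T ‖ ≡ suc n × f T ≡ f (best n)
    attained n with argmax-all f {P = λ T → IsDAry d T × ‖ T ‖ ≡ suc n} (caterpillar-dary 2≤d n , ‖caterpillar‖ n)
                      (all-filter (λ T → isDAry? d T ×-dec ‖ T ‖ ≟ suc n) (treesOfHeight≤ d n))
    ... | dary , size = best n , dary , size , refl
    maximal : ∀ n {T} → IsDAry d T → ‖ T ‖ ≡ suc n → f T ℚ.≤ f (best n)
    maximal n dary size = All.lookup (f[xs]≤f[argmax] (caterpillar n) (candidates n))
      (∈-filter⁺ (λ T → isDAry? d T ×-dec ‖ T ‖ ≟ suc n) (∈-treesOfHeight≤ n dary (≤-reflexive size)) (dary , size))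

-- The limit superior of the maximum densities

binomial-positive : ∀ {n k} → k ≤ n → 1 ≤ n C k
binomial-positive {n} {k} k≤n with n C k | binomial-factorials k≤n
... | zero  | 0≡n! = contradiction (sym 0≡n!) (≢-nonZero⁻¹ (n !) {{n !≢0}})
... | suc _ | _    = s≤s z≤n

n≤[2+e]^n : ∀ e n → n ≤ (2 + e) ^ n
n≤[2+e]^n e zero    = z≤n
n≤[2+e]^n e (suc n) = begin
  1 + n                                ≤⟨ +-mono-≤ (m^n>0 (2 + e) n) (n≤[2+e]^n e n) ⟩
  (2 + e) ^ n + (2 + e) ^ n            ≤⟨ +-monoʳ-≤ ((2 + e) ^ n) (m≤m+n _ _) ⟩
  (2 + e) ^ suc n                      ∎
  where open ≤-Reasoning

module _ {e : ℕ} {c : ℚ} {k : ℕ} {E : Tree}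
         (size : ‖ E ‖ ≡ k) (asym : Asymptotics (2 + e) c k E) where
  open Asymptotics asym

  private
    d = 2 + e
    L = fromℕ (k !) ℚ.* c

    L-value : L ℚ.* fromℕ den ≡ fromℕ (k ! * num)
    L-value = trans (ℚ.*-assoc (fromℕ (k !)) c (fromℕ den))
                    (trans (cong (fromℕ (k !) ℚ.*_) value) (sym (fromℕ-* (k !) num)))

  γ-value : ∀ {T n} → ‖ T ‖ ≡ n → k ≤ n → γ E T ℚ.* fromℕ (n C k) ≡ fromℕ (copies E T)
  γ-value {T} refl k≤n = trans
    (cong (λ r → γ E T ℚ.* fromℕ (‖ T ‖ C r)) (sym size))
    (÷₀-cancel (fromℕ (copies E T)) (binomial-positive (subst (_≤ ‖ T ‖) (sym size) k≤n)))

  density-below : ∀ {ε} → 0ℚ ℚ.< ε → ∃[ N ] ∀ n → N ≤ n → 1 ≤ n × (∀ T → IsDAry d T → ‖ T ‖ ≡ n → γ E T ℚ.< L ℚ.+ ε)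
  density-below {ε} 0<ε =
    let m , 1≤m , εm = archimedean 0<ε
        N , below    = eventually-below num den k m 1≤den
    in N , λ n N≤n → proj₁ (below n N≤n) , go m 1≤m εm n (below n N≤n)
    where
    exch : ∀ a b c → a * b * c ≡ a * c * b
    exch = solve-∀
    go : ∀ m → 1 ≤ m → 1ℚ ℚ.≤ ε ℚ.* fromℕ m → ∀ n → 1 ≤ n × k ≤ n ×
         (∀ X → den * X ≤ num * n ^ k → X * den * m < k ! * num * m * (n C k) + (n C k) * den) →
         ∀ T → IsDAry d T → ‖ T ‖ ≡ n → γ E T ℚ.< L ℚ.+ ε
    go m 1≤m εm n (_ , k≤n , bound) T dary ‖T‖≡n =
      <-cross {L} {γ E T} {ε} {den} {k ! * num} {n C k} {copies E T} {m} 1≤den (binomial-positive {n} {k} k≤n) 1≤m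
        L-value (γ-value {T} {n} ‖T‖≡n k≤n) εm (begin-strict
          copies E T * den * m                       <⟨ bound (copies E T) (subst (λ r → den * copies E T ≤ num * r ^ k) ‖T‖≡n (upper T dary)) ⟩
          k ! * num * m * (n C k) + (n C k) * den    ≡⟨ cong (_+ (n C k) * den) (exch (k ! * num) m (n C k)) ⟩
          k ! * num * (n C k) * m + (n C k) * den    ∎)
      where open ≤-Reasoning

  density-above : ∀ {ε} → 0ℚ ℚ.< ε → ∀ N → ∃[ n ] N ≤ n × 1 ≤ n ×
                  (∃[ T ] IsDAry d T × ‖ T ‖ ≡ n × L ℚ.< γ E T ℚ.+ ε)
  density-above {ε} 0<ε N =
    let m , 1≤m , εm = archimedean 0<ε
        N′ , above   = eventually-above num den k m 1≤den error
        -- Since `h ≤ d ^ h`, this height brings the number of leaves past both thresholds.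
        h            = N + N′
        n            = d ^ h
        1≤n , bounds = above n (≤-trans (m≤n+m N′ N) (n≤[2+e]^n e h))
    in n , ≤-trans (m≤m+n N N′) (n≤[2+e]^n e h) , 1≤n , complete d h , complete-dary e h , ‖complete‖ e h ,
       go m 1≤m εm n {complete d h} (‖complete‖ e h) (lower h) bounds
    where
    exch : ∀ a b c → a * b * c ≡ a * c * b
    exch = solve-∀
    go : ∀ m → 1 ≤ m → 1ℚ ℚ.≤ ε ℚ.* fromℕ m → ∀ n {T} → ‖ T ‖ ≡ n →
         num * n ^ suc k ≤ n * (den * copies E T) + error * n ^ k →
         k ≤ n × (∀ X → num * n ^ suc k ≤ n * (den * X) + error * n ^ k →
                        k ! * num * m * (n C k) < X * den * m + den * (n C k)) →
         L ℚ.< γ E T ℚ.+ ε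
    go m 1≤m εm n {T} ‖T‖≡n many (k≤n , bound) =
      <-cross {γ E T} {L} {ε} {n C k} {copies E T} {den} {k ! * num} {m} (binomial-positive {n} {k} k≤n) 1≤den 1≤m
        (γ-value {T} {n} ‖T‖≡n k≤n) L-value εm (begin-strict
          k ! * num * (n C k) * m                  ≡⟨ exch (k ! * num) (n C k) m ⟩
          k ! * num * m * (n C k)                  <⟨ bound (copies E T) many ⟩
          copies E T * den * m + den * (n C k)     ∎)
      where open ≤-Reasoning

  -- The maximum is the density of some tree, so the bound for all trees applies to it; it is also
  -- at least the density of the complete tree of the same size, whenever there is one.
  inducibility : Inducibility d E L
  inducibility = a , maximum , limsup≤ , limsup≥
    where
    a = proj₁ (tree-maximum {d} (s≤s (s≤s z≤n)) (γ E))
    maximum = proj₂ (tree-maximum {d} (s≤s (s≤s z≤n)) (γ E))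
    limsup≤ : ∀ ε → 0ℚ ℚ.< ε → ∃[ N ] (∀ n → N ≤ n → a n ℚ.< L ℚ.+ ε)
    limsup≤ ε 0<ε =
      let N , bound = density-below 0<ε
      in N , λ n N≤n →
        let 1≤n , all< = bound n N≤n
            T , dary , ‖T‖≡n , γ≡a = proj₁ (maximum n 1≤n)
        in subst (ℚ._< L ℚ.+ ε) γ≡a (all< T dary ‖T‖≡n)
    cancel : ∀ x y → x ℚ.+ y ℚ.- y ≡ x
    cancel = solve 2 (λ x y → x :+ y :- y := x) refl
      where open +-*-Solver
    limsup≥ : ∀ ε → 0ℚ ℚ.< ε → ∀ N → ∃[ n ] N ≤ n × L ℚ.- ε ℚ.< a n
    limsup≥ ε 0<ε N =
      let n , N≤n , 1≤n , T , dary , ‖T‖≡n , L< = density-above 0<ε N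
      in n , N≤n , ℚ.<-≤-trans
           (subst (L ℚ.- ε ℚ.<_) (cancel (γ E T) ε) (ℚ.+-monoˡ-< (ℚ.- ε) L<))
           (proj₂ (maximum n 1≤n) (γ E T) (T , dary , ‖T‖≡n , refl))

theorem1 : (d : ℕ) → 2 ≤ d →
    (c : ℕ → ℚ) → IsEvenConstants d c →
    (k : ℕ) → 1 ≤ k →
    (E : Tree) → IsEven d k E →
    Inducibility d E (fromℕ (k !) ℚ.* c k)
theorem1 (suc (suc e)) (s≤s (s≤s _)) c constants k _ E even =
  inducibility (even-size even) (asymptotics c constants even)
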